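{- An SL grammar-compressed $\Sigma$-labeled dag $D=(V,\gamma,\lambda,G)$ with $G=(N,V,\rho)$ can be transformed in time $O(|D|)$ into a $1$-SLT grammar $G_1$ such that $\mathrm{eval}(G_1)=\mathrm{fcns}(\mathrm{eval}(D))$ and $|G_1|\le |D|+2(|V|+|N|)$.
   Context: Unranked trees over a finite alphabet $\Sigma$ are finite rooted trees with labels in $\Sigma$ and linearly ordered children. An ordered $\Sigma$-labeled rooted dag $(V,\gamma',\lambda)$ has node set $V$, $\gamma':V\to V^*$ giving the ordered successor list, $\lambda:V\to\Sigma$, acyclic with a unique root; its unfolding $\mathrm{eval}$ is the tree $\mathrm{eval}(v)=\lambda(v)(\mathrm{eval}(v_1),\dots,\mathrm{eval}(v_n))$ for $\gamma'(v)=v_1\cdots v_n$, taken at the root. An SL (straight-line) grammar is $G=(N,V,\rho)$ with nonterminals $N$, terminals $V$, $\rho:N\to(N\cup V)^*$ such that the relation "$Y$ occurs in $\rho(X)$" on $N$ is acyclic; $\mathrm{eval}_G(w)\in V^*$ is obtained from $w\in(N\cup V)^*$ by repeatedly replacing nonterminals $X$ by $\rho(X)$; $|G|=\sum_{X\in N}|\rho(X)|$. An SL grammar-compressed $\Sigma$-labeled dag is $D=(V,\gamma,\lambda,G)$ with $G=(N,V,\rho)$ an SL grammar, $\gamma:V\to(V\cup N)^*$, $\lambda:V\to\Sigma$, such that $(V,\gamma',\lambda)$ with $\gamma'(v)=\mathrm{eval}_G(\gamma(v))$ is an ordered rooted dag; $\mathrm{eval}(D)$ is its unfolding and $|D|=|G|+\sum_{v\in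 V}|\gamma(v)|$. The first-child/next-sibling encoding $\mathrm{fcns}(t)$ of an unranked tree $t$ is the binary tree on the nodes of $t$ in which the left child of $u$ is its first child in $t$ and the right child is its next sibling in $t$; binary trees are represented as trees over $\Sigma\cup\{\Box\}$ in which every $\Sigma$-node has exactly two children (left, right) and $\Box$ (a leaf) marks an absent child. A $1$-SLT grammar is $(N_1,\mathrm{rank},\Sigma\cup\{\Box\},S,\rho_1)$ with $\mathrm{rank}:N_1\to\{0,1\}$, start nonterminal $S$, and for each $X\in N_1$ a tree $\rho_1(X)$ over $\Sigma\cup\{\Box\}\cup N_1\cup\{y_1,\dots,y_{\mathrm{rank}(X)}\}$ in which each parameter $y_i$ occurs exactly once, as a leaf, and every node labeled $Y\in N_1$ has $\mathrm{rank}(Y)$ children; the relation "$Y$ occurs in $\rho_1(X)$" is acyclic. $\mathrm{eval}(X)$ is obtained by replacing each $Y$-labeled node by $\mathrm{eval}(Y)$ with its parameter $y_1$ (if any) substituted by the node's child; $\mathrm{eval}(G_1)=\mathrm{eval}(S)$. The size $|G_1|$ is the total number of edges in all right-hand sides, not counting edges to $\Box$-labeled nodes. -}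

module Defs where

open import Data.Bool.Base using (if_then_else_)
open import Data.Fin.Base using (Fin; zero; toℕ)
open import Data.Fin.Induction using (spo-wellFounded)
open import Data.Fin.Properties using () renaming (_≟_ to _≟ᶠ_)
open import Data.List.Base using (List; []; _∷_; [_]; _++_; map; concat; length; tabulate)
open import Data.List.Membership.Propositional using (_∈_; _∉_; mapWith∈)
open import Data.List.Relation.Unary.Any using (here; there)
open import Data.Nat.Base using (ℕ; zero; suc; _+_; _∸_)
open import Data.Nat.ListAction using (sum)
open import Data.Nat.Properties using (_≟_)
open import Data.Product using (Σ-syntax; ∃!; _×_; _,_; proj₁)
open import Data.Sum.Base using (_⊎_; inj₁; inj₂)
open import Data.Vec.Base as Vec using (Vec; []; _∷_)
open import Data.Vec.Relation.Unary.Any as VecAny using (here; there)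
open import Induction.WellFounded using (WellFounded; Acc; acc)
open import Level using (0ℓ)
open import Relation.Binary.Core using (Rel)
open import Relation.Binary.Construct.Closure.Transitive as Plus using (TransClosure)
open import Relation.Binary.PropositionalEquality
  using (_≡_; _≢_; refl; subst; isEquivalence; resp₂)
open import Relation.Nullary using (¬_; does)

Acyclic : ∀ {n} → Rel (Fin n) 0ℓ → Set
Acyclic R = ∀ x → ¬ TransClosure R x x

acyclic⇒wellFounded : ∀ {n} {R : Rel (Fin n) 0ℓ} → Acyclic R → WellFounded R
acyclic⇒wellFounded {R = R} ac = Plus.wellFounded⁻ R (spo-wellFounded record
  { isEquivalence = isEquivalence
  ; irrefl        = λ { refl p → ac _ p }
  ; trans         = Plus._++_
  ; <-resp-≈      = resp₂ (TransClosure R)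
  })

-- The finite alphabet Σ is Fin σ throughout.

data Tree (σ : ℕ) : Set where
  node : Fin σ → List (Tree σ) → Tree σ

record IsRootedDag {V : ℕ} (γ : Fin V → List (Fin V)) : Set where
  field
    acyclic    : Acyclic (λ u v → u ∈ γ v)
    uniqueRoot : ∃! _≡_ (λ r → ∀ v → r ∉ γ v)

module _ {σ V : ℕ} (γ : Fin V → List (Fin V)) (label : Fin V → Fin σ) where

  unfoldAcc : ∀ v → Acc (λ u v → u ∈ γ v) v → Tree σ
  unfoldAcc v (acc rs) =
    node (label v) (mapWith∈ (γ v) (λ {u} u∈ → unfoldAcc u (rs u∈)))

  unfold : IsRootedDag γ → Tree σ
  unfold isDag = unfoldAcc root (acyclic⇒wellFounded acyclic root)
    where
    open IsRootedDag isDag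
    root = proj₁ uniqueRoot

-- Words over nonterminals Fin N and terminals Fin V.
Word : ℕ → ℕ → Set
Word N V = List (Fin N ⊎ Fin V)

record SLGrammar (V : ℕ) : Set where
  field
    N       : ℕ
    ρ       : Fin N → Word N V
    acyclic : Acyclic (λ Y X → inj₁ Y ∈ ρ X)

replace : ∀ {N V} (w : Word N V) → (∀ Y → inj₁ Y ∈ w → List (Fin V)) → List (Fin V)
replace []           f = []
replace (inj₁ Y ∷ w) f = f Y (here refl) ++ replace w (λ Z Z∈ → f Z (there Z∈))
replace (inj₂ v ∷ w) f = v ∷ replace w (λ Z Z∈ → f Z (there Z∈))

module _ {V : ℕ} (G : SLGrammar V) where
  open SLGrammar G

  evalNonterminal : ∀ X → Acc (λ Y X → inj₁ Y ∈ ρ X) X → List (Fin V)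
  evalNonterminal X (acc rs) = replace (ρ X) (λ Y Y∈ → evalNonterminal Y (rs Y∈))

  evalWord : Word N V → List (Fin V)
  evalWord w =
    replace w (λ Y _ → evalNonterminal Y (acyclic⇒wellFounded acyclic Y))

  sizeSL : ℕ
  sizeSL = sum (tabulate (λ X → length (ρ X)))

record CompressedDag (σ : ℕ) : Set where
  field
    V     : ℕ
    G     : SLGrammar V
    γ     : Fin V → Word (SLGrammar.N G) V
    label : Fin V → Fin σ
    isDag : IsRootedDag (λ v → evalWord G (γ v))

  open SLGrammar G public using (N; ρ)

module _ {σ : ℕ} (D : CompressedDag σ) where
  open CompressedDag D

  evalDag : Tree σ
  evalDag = unfold (λ v → evalWord G (γ v)) label isDag

  sizeDag : ℕ
  sizeDag = sizeSL G + sum (tabulate (λ v → length (γ v)))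

-- Binary trees over Σ ∪ {□}, with leaves that may also be parameters.
data BTree (σ k : ℕ) : Set where
  par : Fin k → BTree σ k
  □   : BTree σ k
  bin : Fin σ → (left right : BTree σ k) → BTree σ k

infix 8 _⟦_⟧
_⟦_⟧ : ∀ {σ k l} → BTree σ k → Vec (BTree σ l) k → BTree σ l
par i     ⟦ ts ⟧ = Vec.lookup ts i
□         ⟦ ts ⟧ = □
bin a l r ⟦ ts ⟧ = bin a (l ⟦ ts ⟧) (r ⟦ ts ⟧)

-- The argument lists a node together with its next siblings.
fcnsForest : ∀ {σ} → List (Tree σ) → BTree σ 0
fcnsForest []               = □
fcnsForest (node a us ∷ ts) = bin a (fcnsForest us) (fcnsForest ts)

fcns : ∀ {σ} → Tree σ → BTree σ 0
fcns t = fcnsForest [ t ]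

-- Trees over Σ ∪ {□} ∪ N₁ ∪ {y₁, …, yₖ}, where N₁ = Fin n.
data Term (σ : ℕ) {n : ℕ} (rank : Fin n → Fin 2) (k : ℕ) : Set where
  par : Fin k → Term σ rank k
  □   : Term σ rank k
  bin : Fin σ → (left right : Term σ rank k) → Term σ rank k
  app : (Y : Fin n) → Vec (Term σ rank k) (toℕ (rank Y)) → Term σ rank k

module _ {σ n : ℕ} {rank : Fin n → Fin 2} {k : ℕ} where

  data OccursIn (Y : Fin n) : Term σ rank k → Set where
    root  : ∀ {ts} → OccursIn Y (app Y ts)
    arg   : ∀ {Z ts} → VecAny.Any (OccursIn Y) ts → OccursIn Y (app Z ts)
    left  : ∀ {a l r} → OccursIn Y l → OccursIn Y (bin a l r)
    right : ∀ {a l r} → OccursIn Y r → OccursIn Y (bin a l r)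

  mutual
    parCount : Fin k → Term σ rank k → ℕ
    parCount i (par j)     = if does (i ≟ᶠ j) then 1 else 0
    parCount i □           = 0
    parCount i (bin _ l r) = parCount i l + parCount i r
    parCount i (app _ ts)  = parCounts i ts

    parCounts : ∀ {m} → Fin k → Vec (Term σ rank k) m → ℕ
    parCounts i []       = 0
    parCounts i (t ∷ ts) = parCount i t + parCounts i ts

  mutual
    edges : Term σ rank k → ℕ
    edges (par _)     = 0
    edges □           = 0
    edges (bin _ l r) = edgesInto l + edgesInto r
    edges (app _ ts)  = edgesIntoAll ts

    -- The edges of t together with the edge leading to t, which is not
    -- counted when t is □.
    edgesInto : Term σ rank k → ℕ
    edgesInto □ = 0
    edgesInto t = suc (edges t)

    edgesIntoAll : ∀ {m} → Vec (Term σ rank k) m → ℕ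
    edgesIntoAll []       = 0
    edgesIntoAll (t ∷ ts) = edgesInto t + edgesIntoAll ts

  mutual
    evalTerm : (t : Term σ rank k) → (∀ Y → OccursIn Y t → BTree σ (toℕ (rank Y))) →
               BTree σ k
    evalTerm (par i)     f = par i
    evalTerm □           f = □
    evalTerm (bin a l r) f =
      bin a (evalTerm l (λ Y o → f Y (left o))) (evalTerm r (λ Y o → f Y (right o)))
    evalTerm (app Y ts)  f = f Y root ⟦ evalTerms ts (λ Z o → f Z (arg o)) ⟧

    evalTerms : ∀ {m} (ts : Vec (Term σ rank k) m) →
                (∀ Y → VecAny.Any (OccursIn Y) ts → BTree σ (toℕ (rank Y))) →
                Vec (BTree σ k) m
    evalTerms []       f = []
    evalTerms (t ∷ ts) f =
      evalTerm t (λ Y o → f Y (here o)) ∷ evalTerms ts (λ Y o → f Y (there o))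

record SLTGrammar (σ : ℕ) : Set where
  field
    N₁        : ℕ
    rank      : Fin N₁ → Fin 2
    start     : Fin N₁
    startRank : rank start ≡ zero
    ρ₁        : ∀ X → Term σ rank (toℕ (rank X))
    linear    : ∀ X i → parCount i (ρ₁ X) ≡ 1
    acyclic   : Acyclic (λ Y X → OccursIn Y (ρ₁ X))

module _ {σ : ℕ} (G : SLTGrammar σ) where
  open SLTGrammar G

  evalSLTNonterminal : ∀ X → Acc (λ Y X → OccursIn Y (ρ₁ X)) X → BTree σ (toℕ (rank X))
  evalSLTNonterminal X (acc rs) = evalTerm (ρ₁ X) (λ Y o → evalSLTNonterminal Y (rs o))

  evalSLT : BTree σ 0
  evalSLT = subst (λ r → BTree σ (toℕ r)) startRank
    (evalSLTNonterminal start (acyclic⇒wellFounded acyclic start))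

  sizeSLT : ℕ
  sizeSLT = sum (tabulate (λ X → edges (ρ₁ X)))

-- A unit-cost RAM with addition and truncated subtraction, programmed in
-- structured form. It has registers and arrays, both named by numerals
-- fixed in the program text (so a program uses finitely many of them), all
-- initially 0. The read-only input is a table of rows of numbers; an entry
-- and the length of a row are each read in one step, and reading outside
-- the table gives 0. The output is a write-only sequence of numbers.

Reg Arr : Set
Reg = ℕ
Arr = ℕ

data Expr : Set where
  lit         : ℕ → Expr
  reg         : Reg → Expr
  arr         : Arr → Expr → Expr
  rowLength   : (row : Expr) → Expr
  entry       : (row column : Expr) → Expr
  _⊕_ _⊖_     : Expr → Expr → Expr

infix  6 _≔_ _[_]≔_
infixr 5 _⨾_

data Program : Set where
  skip    : Program
  _≔_     : Reg → Expr → Program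
  _[_]≔_  : Arr → (index value : Expr) → Program
  emit    : Expr → Program
  _⨾_     : Program → Program → Program
  ifNZ    : Expr → (then else : Program) → Program
  whileNZ : Expr → Program → Program

Input : Set
Input = List (List ℕ)

record Store : Set where
  constructor store
  field
    regs   : Reg → ℕ
    arrs   : Arr → ℕ → ℕ
    output : List ℕ
open Store

lookupOr : ∀ {A : Set} → A → List A → ℕ → A
lookupOr d []       _       = d
lookupOr d (x ∷ _)  zero    = x
lookupOr d (_ ∷ xs) (suc i) = lookupOr d xs i

update : ∀ {A : Set} → (ℕ → A) → ℕ → A → ℕ → A
update f i a j = if does (i ≟ j) then a else f j

initial : Store
initial = store (λ _ → 0) (λ _ _ → 0) []

module _ (input : Input) where

  value : Expr → Store → ℕ
  value (lit n)       s = n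
  value (reg x)       s = regs s x
  value (arr a e)     s = arrs s a (value e s)
  value (rowLength e) s = length (lookupOr [] input (value e s))
  value (entry e f)   s = lookupOr 0 (lookupOr [] input (value e s)) (value f s)
  value (e ⊕ f)       s = value e s + value f s
  value (e ⊖ f)       s = value e s ∸ value f s

  -- Run p s t s′: started in s, p halts in s′ after t steps. Every executed
  -- assignment, output and test is one step; the expressions of a fixed
  -- program have bounded size, so this is up to a constant factor (depending
  -- on the program) the number of elementary operations.
  data Run : Program → Store → ℕ → Store → Set where
    skip : ∀ {s} → Run skip s 1 s
    assign : ∀ {x e s} →
      Run (x ≔ e) s 1 (record s { regs = update (regs s) x (value e s) })
    write : ∀ {a e f s} →
      Run (a [ e ]≔ f) s 1
        (record s { arrs = update (arrs s) a (update (arrs s a) (value e s) (value f s)) })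
    emit : ∀ {e s} →
      Run (emit e) s 1 (record s { output = output s ++ [ value e s ] })
    _⨾_ : ∀ {p q s s′ s″ t u} →
      Run p s t s′ → Run q s′ u s″ → Run (p ⨾ q) s (t + u) s″
    if-true : ∀ {e p q s s′ t} →
      value e s ≢ 0 → Run p s t s′ → Run (ifNZ e p q) s (suc t) s′
    if-false : ∀ {e p q s s′ t} →
      value e s ≡ 0 → Run q s t s′ → Run (ifNZ e p q) s (suc t) s′
    while-stop : ∀ {e p s} →
      value e s ≡ 0 → Run (whileNZ e p) s 1 s
    while-step : ∀ {e p s s′ s″ t u} →
      value e s ≢ 0 → Run p s t s′ → Run (whileNZ e p) s′ u s″ →
      Run (whileNZ e p) s (suc (t + u)) s″

-- On the given input, p halts after exactly t steps with the given output.
ComputesIn : Program → Input → List ℕ → ℕ → Set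
ComputesIn p input out t =
  Σ[ s ∈ Store ] (Run input p initial t s × output s ≡ out)

-- Row 0 holds |V| and |N|, row 1 the labels. A node v is coded by v and a
-- nonterminal X by |V| + X, and the row with index 2 + code holds γ(v) or
-- ρ(X), respectively.
module _ {σ : ℕ} (D : CompressedDag σ) where
  open CompressedDag D

  symbolCode : Fin N ⊎ Fin V → ℕ
  symbolCode (inj₁ X) = V + toℕ X
  symbolCode (inj₂ v) = toℕ v

  encodeDag : Input
  encodeDag = (V ∷ N ∷ [])
            ∷ tabulate (λ v → toℕ (label v))
            ∷ tabulate (λ v → map symbolCode (γ v))
           ++ tabulate (λ X → map symbolCode (ρ X))

-- Terms are written in Polish notation.
module _ {σ n : ℕ} {rank : Fin n → Fin 2} {k : ℕ} where

  mutual
    encodeTerm : Term σ rank k → List ℕ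
    encodeTerm (par i)     = 0 ∷ toℕ i ∷ []
    encodeTerm □           = 1 ∷ []
    encodeTerm (bin a l r) = 2 ∷ toℕ a ∷ encodeTerm l ++ encodeTerm r
    encodeTerm (app Y ts)  = 3 ∷ toℕ Y ∷ encodeTerms ts

    encodeTerms : ∀ {m} → Vec (Term σ rank k) m → List ℕ
    encodeTerms []       = []
    encodeTerms (t ∷ ts) = encodeTerm t ++ encodeTerms ts

encodeSLT : ∀ {σ} → SLTGrammar σ → List ℕ
encodeSLT G = N₁ ∷ toℕ start ∷ tabulate (λ X → toℕ (rank X))
           ++ concat (tabulate (λ X → encodeTerm (ρ₁ X)))
  where open SLTGrammar G

{-# OPTIONS --safe #-}
-- A node v becomes the context v(y) → λ(v)(γ(v)·□, y) and a nonterminal X the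
-- context X(y) → ρ(X)·y, where a word applied to a tree is the composition of
-- the contexts of its symbols; the start rule is S → r(□) for the root r. Each
-- context then denotes the fcns encoding of a forest with y as the trailing
-- sibling, and a rule has at most one edge more than its word has letters.
--
-- Since |N| is not bounded by |D|, linear time leaves no room for looking at
-- every nonterminal: the grammar contains only the nodes and the nonterminals
-- reachable from them, numbered by a breadth-first search. Every queued symbol
-- except r occurs in the word of a queued symbol, so the queue has at most
-- 1 + |D| entries; and r is the only node which the search never meets in a word.

module Submission where

open import Defs
open import Data.Bool.Base using (if_then_else_)
open import Data.Fin.Base using (Fin; zero; suc; toℕ; fromℕ<)
open import Data.Fin.Properties using (toℕ<n; toℕ-injective; toℕ-fromℕ<; injective⇒≤)
open import Data.List.Base using (List; []; _∷_; [_]; _++_; map; concat; concatMap; foldr; length; lookup; tabulate; drop; applyUpTo)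
open import Data.List.Membership.Propositional using (_∈_; lose)
open import Data.List.Membership.Propositional.Properties using (mapWith∈-cong; mapWith∈≗map; ∈-++⁺ˡ; ∈-++⁺ʳ; ∈-++⁻; ∈-upTo⁺; ∈-concatMap⁺; ∈-map⁺; ∈-map⁻; ∈-applyUpTo⁺)
open import Data.List.Properties using (++-identityʳ; ++-assoc; map-++; applyUpTo-∷ʳ; length-upTo; length-applyUpTo; length-++; length-map; drop-all; map-applyUpTo)
open import Data.List.Relation.Unary.Any as Any using (here; there)
open import Data.List.Relation.Unary.Any.Properties using (lookup-index)
open import Data.Nat.Base using (ℕ; zero; suc; pred; _+_; _*_; _∸_; _≤_; _<_; z≤n; s≤s; z<s; s<s)
open import Data.Nat.ListAction using (sum)
open import Data.Nat.ListAction.Properties using (sum-++)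
open import Data.Nat.Properties
open import Data.Nat.Solver using (module +-*-Solver)
open import Data.Product.Base using (Σ-syntax; _×_; _,_; proj₁; proj₂)
open import Data.Sum.Base as Sum using (_⊎_; inj₁; inj₂)
open import Data.Vec.Base using ([]; _∷_)
open import Data.Vec.Relation.Unary.Any using (here; there)
open import Function.Base using (_∘_; id)
open import Induction.WellFounded using (WellFounded; Acc; acc)
open import Level using (0ℓ)
open import Relation.Binary.Core using (Rel)
open import Relation.Binary.Construct.Closure.Transitive as Plus using (TransClosure)
open import Relation.Binary.PropositionalEquality using (_≡_; _≢_; refl; sym; trans; cong; cong₂; subst; ≢-sym; module ≡-Reasoning)
open import Relation.Nullary using (¬_; yes; no; contradiction)
open import Relation.Nullary.Decidable using (dec-true; dec-false)
open Store

-- Evaluation of grammar-compressed dags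

-- Neither acyclicity in the input yields that of the output: `G` is acyclic among nonterminals, the
-- dag among nodes after evaluation, and a nonterminal with empty value is invisible to the dag. The
-- rules mix both kinds of symbols, so they are ordered by an induction over the grammar nested in
-- one over the dag. The search keeps `seen` apart from `number` because all nodes are numbered
-- before any word is read, so being numbered says nothing about occurring in a word. Restricting
-- the scan to reachable nonterminals matters for correctness as well as for time: an unreachable
-- one may have the root in its right-hand side, since the root condition concerns evaluated words
-- only. The grammar is not fixed beforehand but read off from the store in which the search halts.
-- The time bound has the form `40 * (1 + sizeDag D)` because `sizeDag D` can be 0, for a single
-- node with an empty word, and a grammar must be written even then.

wellFounded⇒acyclic : ∀ {n} {R : Rel (Fin n) 0ℓ} → WellFounded R → Acyclic R
wellFounded⇒acyclic {R = R} wf x = irreflexive x (Plus.wellFounded R wf x)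
  where
  irreflexive : ∀ x → Acc (TransClosure R) x → ¬ TransClosure R x x
  irreflexive x (acc rs) p = irreflexive x (rs p) p

module Semantics {σ : ℕ} (D : CompressedDag σ) where
  open CompressedDag D

  Symbol : Set
  Symbol = Fin N ⊎ Fin V

  body : Symbol → Word N V
  body (inj₁ X) = ρ X
  body (inj₂ v) = γ v

  wfG : WellFounded (λ Y X → inj₁ Y ∈ ρ X)
  wfG = acyclic⇒wellFounded (SLGrammar.acyclic G)

  children : Fin V → List (Fin V)
  children v = evalWord G (γ v)

  wfD : WellFounded (λ u v → u ∈ children v)
  wfD = acyclic⇒wellFounded (IsRootedDag.acyclic isDag)

  dagRoot : Fin V
  dagRoot = proj₁ (IsRootedDag.uniqueRoot isDag)

  expand : Symbol → List (Fin V)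
  expand (inj₁ X) = evalNonterminal G X (wfG X)
  expand (inj₂ v) = [ v ]

  evalWord≡concatMap : (w : Word N V) → evalWord G w ≡ concatMap expand w
  evalWord≡concatMap []           = refl
  evalWord≡concatMap (inj₁ Y ∷ w) = cong (expand (inj₁ Y) ++_) (evalWord≡concatMap w)
  evalWord≡concatMap (inj₂ v ∷ w) = cong (v ∷_) (evalWord≡concatMap w)

  replace-cong : (w : Word N V) {f g : ∀ Y → inj₁ Y ∈ w → List (Fin V)} →
    (∀ Y Y∈w → f Y Y∈w ≡ g Y Y∈w) → replace w f ≡ replace w g
  replace-cong []           f≡g = refl
  replace-cong (inj₁ Y ∷ w) f≡g =
    cong₂ _++_ (f≡g Y (here refl)) (replace-cong w (λ Z → f≡g Z ∘ there))
  replace-cong (inj₂ v ∷ w) f≡g =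
    cong (v ∷_) (replace-cong w (λ Z → f≡g Z ∘ there))

  -- Evaluation recurses on an accessibility proof, and unfolding it once leaves proofs for the
  -- letters that differ from `wfG`. Independence of them gives the plain recursion equation
  -- `expand-nonterminal`; `unfoldAcc-irrelevant` does the same for trees.
  evalNonterminal-irrelevant : ∀ X a b → evalNonterminal G X a ≡ evalNonterminal G X b
  evalNonterminal-irrelevant X (acc rs) (acc rs′) =
    replace-cong (ρ X) (λ Y Y∈ → evalNonterminal-irrelevant Y (rs Y∈) (rs′ Y∈))

  expand-nonterminal : ∀ X → expand (inj₁ X) ≡ evalWord G (ρ X)
  expand-nonterminal X = unroll (wfG X)
    where
    unroll : ∀ a → evalNonterminal G X a ≡ evalWord G (ρ X)
    unroll (acc rs) =
      replace-cong (ρ X) (λ Y Y∈ → evalNonterminal-irrelevant Y (rs Y∈) (wfG Y))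

  tree : Fin V → Tree σ
  tree v = unfoldAcc children label v (wfD v)

  unfoldAcc-irrelevant : ∀ v a b → unfoldAcc children label v a ≡ unfoldAcc children label v b
  unfoldAcc-irrelevant v (acc rs) (acc rs′) = cong (node (label v))
    (mapWith∈-cong (children v) _ _ (λ u∈ → unfoldAcc-irrelevant _ (rs u∈) (rs′ u∈)))

  tree-unfold : ∀ v → tree v ≡ node (label v) (map tree (children v))
  tree-unfold v = unroll (wfD v)
    where
    unroll : ∀ a → unfoldAcc children label v a ≡ node (label v) (map tree (children v))
    unroll (acc rs) = cong (node (label v)) (trans
      (mapWith∈-cong (children v) _ _ (λ u∈ → unfoldAcc-irrelevant _ (rs u∈) (wfD _)))
      (mapWith∈≗map tree (children v)))

  ∈-evalWord⁺ : ∀ {x v} (w : Word N V) → x ∈ w → v ∈ expand x → v ∈ evalWord G w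
  ∈-evalWord⁺ {v = v} w x∈w v∈x = subst (v ∈_) (sym (evalWord≡concatMap w)) (go w x∈w)
    where
    go : (w : Word N V) → _ ∈ w → v ∈ concatMap expand w
    go (y ∷ w) (here refl) = ∈-++⁺ˡ v∈x
    go (y ∷ w) (there x∈w) = ∈-++⁺ʳ (expand y) (go w x∈w)

  ∈-evalWord⁻ : ∀ {v} (w : Word N V) → v ∈ evalWord G w → Σ[ x ∈ Symbol ] (x ∈ w × v ∈ expand x)
  ∈-evalWord⁻ {v} w v∈ = go w (subst (v ∈_) (evalWord≡concatMap w) v∈)
    where
    go : (w : Word N V) → v ∈ concatMap expand w → Σ[ x ∈ Symbol ] (x ∈ w × v ∈ expand x)
    go (y ∷ w) v∈ with ∈-++⁻ (expand y) v∈
    ... | inj₁ v∈y = y , here refl , v∈y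
    ... | inj₂ v∈w = let x , x∈w , v∈x = go w v∈w in x , there x∈w , v∈x

  -- The inner induction, along `G` only. Its hypothesis about nodes is handed down to a letter `Y`
  -- of `ρ X` because the nodes in `expand` of `Y` are among those of `X`. The outer induction
  -- `vertex-acc` discharges it: the nodes under a letter of `γ v` are children of `v`.
  nonterminal-acc : ∀ X → Acc (λ Y X → inj₁ Y ∈ ρ X) X →
    (∀ {v} → v ∈ expand (inj₁ X) → Acc (λ y x → y ∈ body x) (inj₂ v)) →
    Acc (λ y x → y ∈ body x) (inj₁ X)
  nonterminal-acc X (acc rs) vertices = acc λ
      { {inj₁ Y} Y∈ → nonterminal-acc Y (rs Y∈) (λ v∈ → vertices (inside Y∈ v∈))
      ; {inj₂ v} v∈ → vertices (inside v∈ (here refl))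
      }
    where
    inside : ∀ {y v} → y ∈ ρ X → v ∈ expand y → v ∈ expand (inj₁ X)
    inside {v = v} y∈ v∈y =
      subst (v ∈_) (sym (expand-nonterminal X)) (∈-evalWord⁺ (ρ X) y∈ v∈y)

  vertex-acc : ∀ v → Acc (λ u v → u ∈ children v) v → Acc (λ y x → y ∈ body x) (inj₂ v)
  vertex-acc v (acc rs) = acc λ
    { {inj₁ Y} Y∈ →
        nonterminal-acc Y (wfG Y) (λ u∈ → vertex-acc _ (rs (∈-evalWord⁺ (γ v) Y∈ u∈)))
    ; {inj₂ u} u∈ → vertex-acc u (rs (∈-evalWord⁺ (γ v) u∈ (here refl)))
    }

  body-wellFounded : WellFounded (λ y x → y ∈ body x)
  body-wellFounded (inj₁ X) = nonterminal-acc X (wfG X) (λ _ → vertex-acc _ (wfD _))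
  body-wellFounded (inj₂ v) = vertex-acc v (wfD v)

-- The 1-SLT grammar of a numbering of symbols

-- fcnsForest with the rightmost □ of the encoding replaced by e.
fcnsOnto : ∀ {σ k} → List (Tree σ) → BTree σ k → BTree σ k
fcnsOnto []               e = e
fcnsOnto (node a us ∷ ts) e = bin a (fcnsOnto us □) (fcnsOnto ts e)

fcnsOnto-□ : ∀ {σ} (ts : List (Tree σ)) → fcnsOnto ts □ ≡ fcnsForest ts
fcnsOnto-□ []               = refl
fcnsOnto-□ (node a us ∷ ts) = cong₂ (bin a) (fcnsOnto-□ us) (fcnsOnto-□ ts)

fcnsOnto-⟦⟧ : ∀ {σ k l} (ts : List (Tree σ)) (e : BTree σ k) es →
  fcnsOnto {k = k} ts e ⟦ es ⟧ ≡ fcnsOnto {k = l} ts (e ⟦ es ⟧)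
fcnsOnto-⟦⟧ []               e es = refl
fcnsOnto-⟦⟧ (node a us ∷ ts) e es = cong₂ (bin a) (fcnsOnto-⟦⟧ us □ es) (fcnsOnto-⟦⟧ ts e es)

-- Concatenation of forests becomes composition of contexts, which is why a grammar for sibling
-- words turns into rules with one parameter.
fcnsOnto-++ : ∀ {σ k} (ts us : List (Tree σ)) (e : BTree σ k) →
  fcnsOnto (ts ++ us) e ≡ fcnsOnto ts (fcnsOnto us e)
fcnsOnto-++ []               us e = refl
fcnsOnto-++ (node a ws ∷ ts) us e = cong (bin a _) (fcnsOnto-++ ts us e)

module _ {σ : ℕ} (D : CompressedDag σ) where
  open CompressedDag D
  open Semantics D

  -- `index` is total, so that terms are built from a word without proofs that its letters are
  -- numbered. It has to be inverted by `item` only where the rules refer to it: at the letters of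
  -- the bodies of items and at the root.
  record Numbering : Set where
    field
      size       : ℕ
      item       : Fin size → Symbol
      index      : Symbol → Fin size
      closed     : ∀ i {x} → x ∈ body (item i) → item (index x) ≡ x
      item-root  : item (index (inj₂ dagRoot)) ≡ inj₂ dagRoot

module Translation {σ : ℕ} (D : CompressedDag σ) (numbering : Numbering D) where
  open CompressedDag D
  open Semantics D
  open Numbering numbering

  rank : Fin (suc size) → Fin 2
  rank zero    = zero
  rank (suc _) = suc zero

  wordTerm : ∀ {k} → Word N V → Term σ rank k → Term σ rank k
  wordTerm w e = foldr (λ x t → app (suc (index x)) (t ∷ [])) e w

  symbolTerm : Symbol → Term σ rank 1
  symbolTerm (inj₁ X) = wordTerm (ρ X) (par zero)
  symbolTerm (inj₂ v) = bin (label v) (wordTerm (γ v) □) (par zero)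

  rules : ∀ X → Term σ rank (toℕ (rank X))
  rules zero    = wordTerm [ inj₂ dagRoot ] □
  rules (suc i) = symbolTerm (item i)

  parCount-wordTerm : ∀ {k} (i : Fin k) w e → parCount i (wordTerm w e) ≡ parCount i e
  parCount-wordTerm i []      e = refl
  parCount-wordTerm i (x ∷ w) e = trans (+-identityʳ _) (parCount-wordTerm i w e)

  rules-linear : ∀ X i → parCount i (rules X) ≡ 1
  rules-linear (suc j) zero = symbolTerm-linear (item j)
    where
    symbolTerm-linear : ∀ x → parCount zero (symbolTerm x) ≡ 1
    symbolTerm-linear (inj₁ X) = parCount-wordTerm zero (ρ X) (par zero)
    symbolTerm-linear (inj₂ v) = cong (_+ 1) (parCount-wordTerm zero (γ v) □)

  occursIn-wordTerm : ∀ {k Y} w {e : Term σ rank k} → OccursIn Y (wordTerm w e) →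
    (Σ[ x ∈ Symbol ] (x ∈ w × Y ≡ suc (index x))) ⊎ OccursIn Y e
  occursIn-wordTerm []      o              = inj₂ o
  occursIn-wordTerm (x ∷ w) root           = inj₁ (x , here refl , refl)
  occursIn-wordTerm (x ∷ w) (arg (here o)) =
    Sum.map₁ (λ (y , y∈ , eq) → y , there y∈ , eq) (occursIn-wordTerm w o)

  occursIn-symbolTerm : ∀ {Y} x → OccursIn Y (symbolTerm x) →
    Σ[ y ∈ Symbol ] (y ∈ body x × Y ≡ suc (index y))
  occursIn-symbolTerm (inj₁ X) o with occursIn-wordTerm (ρ X) o
  ... | inj₁ p = p
  occursIn-symbolTerm (inj₂ v) (left o) with occursIn-wordTerm (γ v) o
  ... | inj₁ p = p

  -- Pulls `body-wellFounded` back to the rules. The equation is a separate argument because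
  -- `item (index y)` is `y` only by `closed`, while the recursion must follow the accessibility of
  -- `y`.
  item-acc : ∀ {x} i → item i ≡ x → Acc (λ y x → y ∈ body x) x →
    Acc (λ Y X → OccursIn Y (rules X)) (suc i)
  item-acc i refl (acc rs) = acc λ o → case-occurs (occursIn-symbolTerm (item i) o)
    where
    case-occurs : ∀ {Y} → Σ[ y ∈ Symbol ] (y ∈ body (item i) × Y ≡ suc (index y)) →
      Acc (λ Y X → OccursIn Y (rules X)) Y
    case-occurs (y , y∈ , refl) = item-acc (index y) (closed i y∈) (rs y∈)

  rules-wellFounded : WellFounded (λ Y X → OccursIn Y (rules X))
  rules-wellFounded zero    = acc λ { root → rules-wellFounded (suc _) ; (arg (here ())) }
  rules-wellFounded (suc i) = item-acc i refl (body-wellFounded (item i))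

  grammar : SLTGrammar σ
  grammar = record
    { N₁        = suc size
    ; rank      = rank
    ; start     = zero
    ; startRank = refl
    ; ρ₁        = rules
    ; linear    = rules-linear
    ; acyclic   = wellFounded⇒acyclic rules-wellFounded
    }

  forest : Symbol → List (Tree σ)
  forest x = map tree (expand x)

  -- The environment is indexed by proofs of occurrence, so passing a letter of `w` restricts `f` to
  -- another function. The last hypothesis says that the value of `e` does not depend on it; it
  -- holds by `refl` for the terms `par zero` and `□` that occur.
  evalTerm-wordTerm : ∀ {k} w {e : Term σ rank k}
    {f : ∀ Y → OccursIn Y (wordTerm w e) → BTree σ (toℕ (rank Y))}
    {g : ∀ Y → OccursIn Y e → BTree σ (toℕ (rank Y))} →
    (∀ {x} → x ∈ w → ∀ o → f (suc (index x)) o ≡ fcnsOnto (forest x) (par zero)) →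
    (∀ {f} → evalTerm e f ≡ evalTerm e g) →
    evalTerm (wordTerm w e) f ≡ fcnsOnto (map tree (concatMap expand w)) (evalTerm e g)
  evalTerm-wordTerm []      f≡ e≡ = e≡
  evalTerm-wordTerm (x ∷ w) {e} {f} {g} f≡ e≡
    rewrite f≡ (here refl) root
          | fcnsOnto-⟦⟧ (forest x) (par zero)
              (evalTerm (wordTerm w e) (λ Z o → f Z (arg (here o))) ∷ [])
          | evalTerm-wordTerm w {e} {λ Z o → f Z (arg (here o))} {g}
              (λ x∈ o → f≡ (there x∈) (arg (here o))) e≡
          | map-++ tree (expand x) (concatMap expand w)
    = sym (fcnsOnto-++ (forest x) _ _)

  evalTerm-symbolTerm : ∀ x {f : ∀ Y → OccursIn Y (symbolTerm x) → BTree σ (toℕ (rank Y))} →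
    (∀ {y} → y ∈ body x → ∀ o → f (suc (index y)) o ≡ fcnsOnto (forest y) (par zero)) →
    evalTerm (symbolTerm x) f ≡ fcnsOnto (forest x) (par zero)
  evalTerm-symbolTerm (inj₁ X) {f} f≡ = trans
    (evalTerm-wordTerm (ρ X) {par zero} {g = λ _ ()} f≡ refl)
    (cong (λ vs → fcnsOnto (map tree vs) (par zero))
      (sym (trans (expand-nonterminal X) (evalWord≡concatMap (ρ X)))))
  evalTerm-symbolTerm (inj₂ v) {f} f≡
    rewrite evalTerm-wordTerm (γ v) {□} {λ Y o → f Y (left o)} {λ _ ()} (λ y∈ o → f≡ y∈ (left o)) refl
          | tree-unfold v
          | evalWord≡concatMap (γ v)
    = refl

  evalSLTNonterminal-item : ∀ i a →
    evalSLTNonterminal grammar (suc i) a ≡ fcnsOnto (forest (item i)) (par zero)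
  evalSLTNonterminal-item i (acc rs) = evalTerm-symbolTerm (item i) λ {y} y∈ o →
    trans (evalSLTNonterminal-item (index y) (rs o))
          (cong (λ x → fcnsOnto (forest x) (par zero)) (closed i y∈))

  evalSLT-grammar : evalSLT grammar ≡ fcns (evalDag D)
  evalSLT-grammar = at-start (acyclic⇒wellFounded (SLTGrammar.acyclic grammar) zero)
    where
    at-start : ∀ a → evalSLTNonterminal grammar zero a ≡ fcns (tree dagRoot)
    at-start (acc rs)
      rewrite evalSLTNonterminal-item (index (inj₂ dagRoot)) (rs root) | item-root
      = trans (fcnsOnto-⟦⟧ (forest (inj₂ dagRoot)) (par zero) _)
              (fcnsOnto-□ (forest (inj₂ dagRoot)))

  edgesInto-wordTerm : ∀ {k} w (e : Term σ rank k) →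
    edgesInto (wordTerm w e) ≤ length w + edgesInto e
  edgesInto-wordTerm []      e = ≤-refl
  edgesInto-wordTerm (x ∷ w) e =
    s≤s (≤-trans (≤-reflexive (+-identityʳ _)) (edgesInto-wordTerm w e))

  edges≤edgesInto : ∀ {k} (t : Term σ rank k) → edges t ≤ edgesInto t
  edges≤edgesInto (par _)     = z≤n
  edges≤edgesInto □           = z≤n
  edges≤edgesInto (bin _ _ _) = n≤1+n _
  edges≤edgesInto (app _ _)   = n≤1+n _

  -- In the rule of a node the chain of `γ v` ends in `□`, whose edge is free, so the chain costs at
  -- most one edge per letter and the extra one leads to the parameter. In the rule of a nonterminal
  -- the extra one comes from `edgesInto`.
  edges-symbolTerm : ∀ x → edges (symbolTerm x) ≤ length (body x) + 1
  edges-symbolTerm (inj₁ X) =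
    ≤-trans (edges≤edgesInto (symbolTerm (inj₁ X))) (edgesInto-wordTerm (ρ X) (par zero))
  edges-symbolTerm (inj₂ v) = +-mono-≤
    (≤-trans (edgesInto-wordTerm (γ v) □) (≤-reflexive (+-identityʳ _))) ≤-refl

-- Sums and lists

update-same : ∀ {A : Set} (f : ℕ → A) i a → update f i a i ≡ a
update-same f i a = cong (λ b → if b then a else f i) (dec-true (i ≟ i) refl)

update-other : ∀ {A : Set} (f : ℕ → A) {i j} a → i ≢ j → update f i a j ≡ f j
update-other f {i} {j} a i≢j = cong (λ b → if b then a else f j) (dec-false (i ≟ j) i≢j)

update-nonzero : ∀ (f : ℕ → ℕ) i {j} a → f j ≢ 0 → update f i (suc a) j ≢ 0
update-nonzero f i {j} a fj≢0 with i ≟ j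
... | yes refl = λ eq → 1+n≢0 (trans (sym (update-same f i (suc a))) eq)
... | no i≢j = λ eq → fj≢0 (trans (sym (update-other f (suc a) i≢j)) eq)

sumTo : (ℕ → ℕ) → ℕ → ℕ
sumTo f n = sum (applyUpTo f n)

sumTo-suc : ∀ f n → sumTo f (suc n) ≡ sumTo f n + f n
sumTo-suc f n = begin
  sum (applyUpTo f (suc n))        ≡⟨ cong sum (applyUpTo-∷ʳ f n) ⟨
  sum (applyUpTo f n ++ [ f n ])   ≡⟨ sum-++ (applyUpTo f n) [ f n ] ⟩
  sumTo f n + (f n + 0)            ≡⟨ cong (sumTo f n +_) (+-identityʳ (f n)) ⟩
  sumTo f n + f n                  ∎
  where open ≡-Reasoning

sumTo-cong : ∀ {f g} n → (∀ {i} → i < n → f i ≡ g i) → sumTo f n ≡ sumTo g n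
sumTo-cong zero    f≡g = refl
sumTo-cong (suc n) f≡g = cong₂ _+_ (f≡g z<s) (sumTo-cong n (f≡g ∘ s<s))

sumTo-const : ∀ c n → sumTo (λ _ → c) n ≡ n * c
sumTo-const c zero    = refl
sumTo-const c (suc n) = cong (c +_) (sumTo-const c n)

sumTo-affine : ∀ a b f n → sumTo (λ i → a + b * f i) n ≡ a * n + b * sumTo f n
sumTo-affine a b f zero    = sym (cong₂ _+_ (*-zeroʳ a) (*-zeroʳ b))
sumTo-affine a b f (suc n) = trans
  (cong (a + b * f 0 +_) (sumTo-affine a b (f ∘ suc) n))
  (solve 5 (λ a b x n y → (a :+ b :* x) :+ (a :* n :+ b :* y) := a :* (con 1 :+ n) :+ b :* (x :+ y))
    refl a b (f 0) n (sumTo (f ∘ suc) n))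
  where open +-*-Solver

sumTo-+ : ∀ f m n → sumTo f (m + n) ≡ sumTo f m + sumTo (f ∘ (m +_)) n
sumTo-+ f zero    n = refl
sumTo-+ f (suc m) n = trans (cong (f 0 +_) (sumTo-+ (f ∘ suc) m n)) (sym (+-assoc (f 0) _ _))

sum-tabulate-≤ : ∀ {n} {f : Fin n → ℕ} g → (∀ i → f i ≤ g (toℕ i)) → sum (tabulate f) ≤ sumTo g n
sum-tabulate-≤ {zero}  g f≤g = z≤n
sum-tabulate-≤ {suc n} g f≤g = +-mono-≤ (f≤g zero) (sum-tabulate-≤ (g ∘ suc) (f≤g ∘ suc))

sumTo-update : ∀ f {n c} → c < n → sumTo (update f c 0) n + f c ≡ sumTo f n
sumTo-update f {suc n} {c} c<1+n with c ≟ n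
... | yes refl = begin
    sumTo (update f c 0) (suc c) + f c
      ≡⟨ cong (_+ f c) (sumTo-suc (update f c 0) c) ⟩
    sumTo (update f c 0) c + update f c 0 c + f c
      ≡⟨ cong₂ (λ x y → x + y + f c)
           (sumTo-cong c (λ i<c → update-other f 0 (≢-sym (<⇒≢ i<c)))) (update-same f c 0) ⟩
    sumTo f c + 0 + f c  ≡⟨ cong (_+ f c) (+-identityʳ (sumTo f c)) ⟩
    sumTo f c + f c      ≡⟨ sumTo-suc f c ⟨
    sumTo f (suc c)      ∎
  where open ≡-Reasoning
... | no c≢n = begin
    sumTo (update f c 0) (suc n) + f c
      ≡⟨ cong (_+ f c) (sumTo-suc (update f c 0) n) ⟩
    sumTo (update f c 0) n + update f c 0 n + f c
      ≡⟨ cong (λ x → sumTo (update f c 0) n + x + f c) (update-other f 0 c≢n) ⟩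
    sumTo (update f c 0) n + f n + f c
      ≡⟨ +-assoc (sumTo (update f c 0) n) (f n) (f c) ⟩
    sumTo (update f c 0) n + (f n + f c)
      ≡⟨ cong (sumTo (update f c 0) n +_) (+-comm (f n) (f c)) ⟩
    sumTo (update f c 0) n + (f c + f n)
      ≡⟨ +-assoc (sumTo (update f c 0) n) (f c) (f n) ⟨
    sumTo (update f c 0) n + f c + f n
      ≡⟨ cong (_+ f n) (sumTo-update f (≤∧≢⇒< (≤-pred c<1+n) c≢n)) ⟩
    sumTo f n + f n  ≡⟨ sumTo-suc f n ⟨
    sumTo f (suc n)  ∎
  where open ≡-Reasoning

InjectiveBelow : ℕ → (ℕ → ℕ) → Set
InjectiveBelow n q = ∀ {i j} → i < n → j < n → q i ≡ q j → i ≡ j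

-- Summing in the order of q, each weight is zeroed once it has been used.
sumTo-injective : ∀ w q n {m} → InjectiveBelow n q → (∀ {i} → i < n → q i < m) →
  sumTo (w ∘ q) n ≤ sumTo w m
sumTo-injective w q zero    inj q<m = z≤n
sumTo-injective w q (suc n) {m} inj q<m = begin
  sumTo (w ∘ q) (suc n)
    ≡⟨ sumTo-suc (w ∘ q) n ⟩
  sumTo (w ∘ q) n + w (q n)
    ≡⟨ cong (_+ w (q n)) (sumTo-cong n λ i<n → sym (update-other w 0
         (λ eq → <⇒≢ i<n (inj (m<n⇒m<1+n i<n) ≤-refl (sym eq))))) ⟩
  sumTo (update w (q n) 0 ∘ q) n + w (q n)
    ≤⟨ +-monoˡ-≤ (w (q n)) (sumTo-injective (update w (q n) 0) q n
         (λ i<n j<n → inj (m<n⇒m<1+n i<n) (m<n⇒m<1+n j<n)) (q<m ∘ m<n⇒m<1+n)) ⟩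
  sumTo (update w (q n) 0) m + w (q n)
    ≡⟨ sumTo-update w (q<m ≤-refl) ⟩
  sumTo w m ∎
  where open ≤-Reasoning

-- Pigeonhole: the positions `Any.index` at which the values are found are distinct, because looking
-- up such a position returns the value.
injective⇒≤length : ∀ {q n} {xs : List ℕ} → InjectiveBelow n q → (∀ {i} → i < n → q i ∈ xs) →
  n ≤ length xs
injective⇒≤length {q} {n} {xs} inj q∈xs = injective⇒≤ {f = λ i → Any.index (q∈xs (toℕ<n i))}
  λ {i} {j} eq → toℕ-injective (inj (toℕ<n i) (toℕ<n j) (begin
    q (toℕ i)  ≡⟨ lookup-index (q∈xs (toℕ<n i)) ⟩
    _          ≡⟨ cong (lookup xs) eq ⟩
    _          ≡⟨ lookup-index (q∈xs (toℕ<n j)) ⟨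
    q (toℕ j)  ∎))
  where open ≡-Reasoning

length-concatMap-applyUpTo : ∀ (g : ℕ → List ℕ) q n →
  length (concatMap g (applyUpTo q n)) ≡ sumTo (length ∘ g ∘ q) n
length-concatMap-applyUpTo g q zero    = refl
length-concatMap-applyUpTo g q (suc n) = trans (length-++ (g (q 0)))
  (cong (length (g (q 0)) +_) (length-concatMap-applyUpTo g (q ∘ suc) n))

lookupOr∈ : ∀ {A : Set} (d : A) {xs i} → i < length xs → lookupOr d xs i ∈ xs
lookupOr∈ d {x ∷ xs} {zero}  _           = here refl
lookupOr∈ d {x ∷ xs} {suc i} (s≤s i<len) = there (lookupOr∈ d i<len)

∈⇒lookupOr : ∀ {A : Set} (d : A) {x xs} → x ∈ xs →
  Σ[ i ∈ ℕ ] (i < length xs × lookupOr d xs i ≡ x)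
∈⇒lookupOr d (here refl) = 0 , z<s , refl
∈⇒lookupOr d (there x∈)  = let i , i< , eq = ∈⇒lookupOr d x∈ in suc i , s<s i< , eq

drop-lookupOr : ∀ {A : Set} (d : A) {xs i} → i < length xs →
  drop i xs ≡ lookupOr d xs i ∷ drop (suc i) xs
drop-lookupOr d {x ∷ xs} {zero}  _           = refl
drop-lookupOr d {x ∷ xs} {suc i} (s≤s i<len) = drop-lookupOr d i<len

lookupOr-applyUpTo : ∀ {A : Set} (d : A) f {n i} → i < n → lookupOr d (applyUpTo f n) i ≡ f i
lookupOr-applyUpTo d f {suc n} {zero}  _         = refl
lookupOr-applyUpTo d f {suc n} {suc i} (s≤s i<n) = lookupOr-applyUpTo d (f ∘ suc) i<n

lookupOr-tabulate-++ˡ : ∀ {A : Set} (d : A) {n} (f : Fin n → A) ys i →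
  lookupOr d (tabulate f ++ ys) (toℕ i) ≡ f i
lookupOr-tabulate-++ˡ d f ys zero    = refl
lookupOr-tabulate-++ˡ d f ys (suc i) = lookupOr-tabulate-++ˡ d (f ∘ suc) ys i

lookupOr-tabulate-++ʳ : ∀ {A : Set} (d : A) {n} (f : Fin n → A) ys i →
  lookupOr d (tabulate f ++ ys) (n + i) ≡ lookupOr d ys i
lookupOr-tabulate-++ʳ d {zero}  f ys i = refl
lookupOr-tabulate-++ʳ d {suc n} f ys i = lookupOr-tabulate-++ʳ d (f ∘ suc) ys i

tabulate≡applyUpTo : ∀ {A : Set} {n} {f : Fin n → A} (g : ℕ → A) → (∀ i → f i ≡ g (toℕ i)) →
  tabulate f ≡ applyUpTo g n
tabulate≡applyUpTo {n = zero}  g eq = refl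
tabulate≡applyUpTo {n = suc n} g eq = cong₂ _∷_ (eq zero) (tabulate≡applyUpTo (g ∘ suc) (eq ∘ suc))

≢0⇒≡suc : ∀ {n} → n ≢ 0 → n ≡ suc (pred n)
≢0⇒≡suc {zero}  n≢0 = contradiction refl n≢0
≢0⇒≡suc {suc n} n≢0 = refl

-- Running time bounds for programs

-- A total-correctness Hoare triple with a cost bound; `_then_` is the rule for sequencing, under
-- which costs add up.
Reaches : Input → Program → Store → ℕ → (Store → Set) → Set
Reaches input p s bound Q =
  Σ[ s′ ∈ Store ] Σ[ t ∈ ℕ ] (Run input p s t s′ × t ≤ bound × Q s′)

emit-next : ∀ {o a r} {out : List ℕ} → o ++ a ∷ r ≡ out → (o ++ [ a ]) ++ r ≡ out
emit-next {o} {a} {r} eq = trans (++-assoc o [ a ] r) eq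

-- The list r is the part of the intended output that remains to be written.
Remaining : List ℕ → List ℕ → Store → Set
Remaining out r s = Store.output s ++ r ≡ out

module _ {input : Input} where

  infixr 5 _then_
  _then_ : ∀ {p q s b c P Q} → Reaches input p s b P →
    (∀ {s′} → P s′ → Reaches input q s′ c Q) → Reaches input (p ⨾ q) s (b + c) Q
  (s′ , t , run , t≤ , P) then f =
    let s″ , u , run′ , u≤ , Q = f P in s″ , t + u , run ⨾ run′ , +-mono-≤ t≤ u≤ , Q

  weaken : ∀ {p s b c Q} → b ≤ c → Reaches input p s b Q → Reaches input p s c Q
  weaken b≤c (s′ , t , run , t≤ , Q) = s′ , t , run , ≤-trans t≤ b≤c , Q

  -- The rule for a loop whose number of rounds is known beforehand. A round pays one step for its
  -- test on top of `cost`, and the leading 1 is the final, failing test.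
  whileNZ-count : ∀ {e p} (I : ℕ → Store → Set) (cost : ℕ → ℕ) m →
    (∀ {k s} → k < m → I k s → value input e s ≢ 0 × Reaches input p s (cost k) (I (suc k))) →
    (∀ {s} → I m s → value input e s ≡ 0) →
    ∀ {s} → I 0 s → Reaches input (whileNZ e p) s (1 + sumTo (suc ∘ cost) m) (I m)
  whileNZ-count I cost zero    step stop i = _ , _ , while-stop (stop i) , ≤-refl , i
  whileNZ-count I cost (suc m) step stop i
    with e≢0 , s₁ , t , run , t≤ , i₁ ← step z<s i
    with s₂ , u , run′ , u≤ , i₂ ←
           whileNZ-count (I ∘ suc) (cost ∘ suc) m (λ k<m → step (s<s k<m)) stop i₁
    = s₂ , _ , while-step e≢0 run run′ , bound , i₂
    where
    bound : suc (t + u) ≤ 1 + (suc (cost 0) + sumTo (suc ∘ cost ∘ suc) m)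
    bound = s≤s (≤-trans (+-mono-≤ t≤ u≤) (≤-reflexive (+-suc (cost 0) _)))

  -- The output still due before round `k` is that of `drop k xs`, and each round takes off its
  -- first block.
  emit-each : ∀ {e p out} (I : ℕ → Store → Set) (cost : ℕ → ℕ) (xs : List ℕ) (g : ℕ → List ℕ) {r} →
    (∀ {k s r} → k < length xs → I k s → Remaining out (g (lookupOr 0 xs k) ++ r) s →
      value input e s ≢ 0 × Reaches input p s (cost k) (λ s′ → I (suc k) s′ × Remaining out r s′)) →
    (∀ {s} → I (length xs) s → value input e s ≡ 0) →
    ∀ {s} → I 0 s → Remaining out (concatMap g xs ++ r) s →
    Reaches input (whileNZ e p) s (1 + sumTo (suc ∘ cost) (length xs))
      (λ s′ → I (length xs) s′ × Remaining out r s′)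
  emit-each {out = out} I cost xs g {r} step stop i rem =
    let s′ , t , run , t≤ , i′ , rem′ = whileNZ-count
          (λ k s → I k s × Remaining out (concatMap g (drop k xs) ++ r) s) cost (length xs)
          (λ {k} {s} k< (i , rem) → step k< i (subst (λ l → Remaining out l s) (split k<) rem))
          (stop ∘ proj₁) (i , rem)
    in s′ , t , run , t≤ , i′ ,
       subst (λ l → Remaining out (concatMap g l ++ r) s′) (drop-all _ xs ≤-refl) rem′
    where
    split : ∀ {k} → k < length xs → concatMap g (drop k xs) ++ r
                                  ≡ g (lookupOr 0 xs k) ++ concatMap g (drop (suc k) xs) ++ r
    split {k} k< = trans (cong (λ l → concatMap g l ++ r) (drop-lookupOr 0 k<))
                         (++-assoc (g (lookupOr 0 xs k)) _ r)

-- Breadth-first search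

queueLength position column symbol vertex : Reg
queueLength = 0
position    = 1
column      = 2
symbol      = 3
vertex      = 4

-- number holds 1 + the queue index of a symbol, and 0 if it was never queued; this
-- is its nonterminal in the grammar, as 0 is the start. seen marks the codes met in
-- the scanned rows.
queue number seen : Arr
queue  = 0
number = 1
seen   = 2

symbolRow : Expr
symbolRow = lit 2 ⊕ arr queue (reg position)

increment : Reg → Program
increment x = x ≔ lit 1 ⊕ reg x

enqueue : Program
enqueue = queue [ reg queueLength ]≔ reg symbol
        ⨾ number [ reg symbol ]≔ lit 1 ⊕ reg queueLength
        ⨾ increment queueLength

-- The root is known only after the search, so the search is seeded with all nodes. `queueLength`
-- serves as the loop counter: as long as only nodes are queued, it is also the code of the next
-- one.
enqueueVertices : Program
enqueueVertices = whileNZ (entry (lit 0) (lit 0) ⊖ reg queueLength)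
  (symbol ≔ reg queueLength ⨾ enqueue)

scanRow : Program
scanRow = whileNZ (rowLength symbolRow ⊖ reg column)
  ( symbol ≔ entry symbolRow (reg column)
  ⨾ seen [ reg symbol ]≔ lit 1
  ⨾ ifNZ (arr number (reg symbol)) skip enqueue
  ⨾ increment column)

explore : Program
explore = whileNZ (reg queueLength ⊖ reg position)
  (column ≔ lit 0 ⨾ scanRow ⨾ increment position)

search : Program
search = enqueueVertices ⨾ position ≔ lit 0 ⨾ explore

findRoot : Program
findRoot = vertex ≔ lit 0 ⨾ whileNZ (arr seen (reg vertex)) (increment vertex)

module Search (input : Input) where

  vertexCount : ℕ
  vertexCount = lookupOr 0 (lookupOr [] input 0) 0

  row : ℕ → List ℕ
  row c = lookupOr [] input (2 + c)

  Good : (Arr → ℕ → ℕ) → ℕ → Set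
  Good A c = A number c ≢ 0 × A seen c ≢ 0

  -- For `number` only being non-zero is preserved, so that enqueueing extends the arrays without
  -- any assumption on the code. Exact numbers are recovered from the preserved queue by
  -- `number-queue`.
  record Extends (A : Arr → ℕ → ℕ) (n : ℕ) (B : Arr → ℕ → ℕ) (m : ℕ) : Set where
    field
      length-≤    : n ≤ m
      queue-≡     : ∀ {i} → i < n → B queue i ≡ A queue i
      number-kept : ∀ {c} → A number c ≢ 0 → B number c ≢ 0
      seen-kept   : ∀ {c} → A seen c ≢ 0 → B seen c ≢ 0

    good-kept : ∀ {c} → Good A c → Good B c
    good-kept (p , q) = number-kept p , seen-kept q

  open Extends

  Extends-refl : ∀ {A n} → Extends A n A n
  Extends-refl = record
    { length-≤ = ≤-refl ; queue-≡ = λ _ → refl ; number-kept = id ; seen-kept = id }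

  Extends-trans : ∀ {A B C n m l} → Extends A n B m → Extends B m C l → Extends A n C l
  Extends-trans e f = record
    { length-≤    = ≤-trans (length-≤ e) (length-≤ f)
    ; queue-≡     = λ i<n → trans (queue-≡ f (<-≤-trans i<n (length-≤ e))) (queue-≡ e i<n)
    ; number-kept = number-kept f ∘ number-kept e
    ; seen-kept   = seen-kept f ∘ seen-kept e
    }

  markSeen : (Arr → ℕ → ℕ) → ℕ → (Arr → ℕ → ℕ)
  markSeen A c = update A seen (update (A seen) c 1)

  enqueued : (Arr → ℕ → ℕ) → ℕ → ℕ → (Arr → ℕ → ℕ)
  enqueued A n c =
    let B = update A queue (update (A queue) n c)
    in update B number (update (B number) c (suc n))

  Extends-markSeen : ∀ {A n} c → Extends A n (markSeen A c) n
  Extends-markSeen {A} c = record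
    { length-≤ = ≤-refl ; queue-≡ = λ _ → refl ; number-kept = id
    ; seen-kept = update-nonzero (A seen) c 0 }

  Extends-enqueued : ∀ {A n} c → Extends A n (enqueued A n c) (suc n)
  Extends-enqueued {A} {n} c = record
    { length-≤    = n≤1+n n
    ; queue-≡     = λ i<n → update-other (A queue) c (≢-sym (<⇒≢ i<n))
    ; number-kept = update-nonzero (A number) c n
    ; seen-kept   = id
    }

  module _ (Valid : ℕ → Set) where

    -- `number-queue` and `queue-number` make `number` the inverse of the queue, so no code is
    -- queued twice. `seen-sound` and `queue-seen` together say that a queued code is a node or
    -- occurs in the row of a queued code; this is what later bounds the queue.
    record Scan (A : Arr → ℕ → ℕ) (n : ℕ) : Set where
      field
        valid        : ∀ {i} → i < n → Valid (A queue i)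
        number-queue : ∀ {i} → i < n → A number (A queue i) ≡ suc i
        queue-number : ∀ {c i} → A number c ≡ suc i → i < n × A queue i ≡ c
        seen-sound   : ∀ {c} → A seen c ≢ 0 → Σ[ i ∈ ℕ ] (i < n × c ∈ row (A queue i))
        queue-seen   : ∀ {i} → i < n → A queue i < vertexCount ⊎ A seen (A queue i) ≢ 0

      queue-injective : InjectiveBelow n (A queue)
      queue-injective i<n j<n eq = suc-injective
        (trans (sym (number-queue i<n)) (trans (cong (A number) eq) (number-queue j<n)))

    Scan-markSeen : ∀ {A n i c} → Scan A n → i < n → c ∈ row (A queue i) → Scan (markSeen A c) n
    Scan-markSeen {A} {n} {i} {c} scan i<n c∈ = record
      { valid        = valid
      ; number-queue = number-queue
      ; queue-number = queue-number
      ; seen-sound   = λ {d} → sound d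
      ; queue-seen   = λ j<n → Sum.map₂ (update-nonzero (A seen) c 0) (queue-seen j<n)
      }
      where
      open Scan scan
      sound : ∀ d → update (A seen) c 1 d ≢ 0 → Σ[ j ∈ ℕ ] (j < n × d ∈ row (A queue j))
      sound d d≢0 with c ≟ d
      ... | yes refl = i , i<n , c∈
      ... | no c≢d   = seen-sound (d≢0 ∘ trans (update-other (A seen) 1 c≢d))

    Scan-enqueued : ∀ {A n c} → Scan A n → Valid c → A number c ≡ 0 →
      c < vertexCount ⊎ A seen c ≢ 0 → Scan (enqueued A n c) (suc n)
    Scan-enqueued {A} {n} {c} scan valid-c c≡0 c-seen = record
      { valid        = λ i< → at Valid valid-c valid i<
      ; number-queue = λ {i} i< → number-queue′ (m<1+n⇒m<n∨m≡n i<)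
      ; queue-number = λ {d} → queue-number′ d
      ; seen-sound   = λ d≢0 → let i , i<n , d∈ = seen-sound d≢0 in
                         i , m<n⇒m<1+n i<n , subst (λ x → _ ∈ row x) (sym (old i<n)) d∈
      ; queue-seen   = λ i< → at (λ d → d < vertexCount ⊎ A seen d ≢ 0) c-seen queue-seen i<
      }
      where
      open Scan scan
      queue′ number′ : ℕ → ℕ
      queue′  = update (A queue) n c
      number′ = update (A number) c (suc n)

      old : ∀ {i} → i < n → queue′ i ≡ A queue i
      old = queue-≡ (Extends-enqueued {A} c)

      at : (P : ℕ → Set) → P c → (∀ {i} → i < n → P (A queue i)) → ∀ {i} → i < suc n → P (queue′ i)
      at P pc p i< with m<1+n⇒m<n∨m≡n i<
      ... | inj₁ i<n  = subst P (sym (old i<n)) (p i<n)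
      ... | inj₂ refl = subst P (sym (update-same (A queue) n c)) pc

      number-queue′ : ∀ {i} → i < n ⊎ i ≡ n → number′ (queue′ i) ≡ suc i
      number-queue′ (inj₁ i<n) = trans (cong number′ (old i<n))
        -- An older entry differs from `c`, for it has a non-zero number and `c` has none.
        (trans (update-other (A number) (suc n)
                 (λ eq → 0≢1+n (trans (sym c≡0) (trans (cong (A number) eq) (number-queue i<n)))))
               (number-queue i<n))
      number-queue′ (inj₂ refl) =
        trans (cong number′ (update-same (A queue) n c)) (update-same (A number) c (suc n))

      queue-number′ : ∀ d {i} → number′ d ≡ suc i → i < suc n × queue′ i ≡ d
      queue-number′ d eq with c ≟ d
      ... | yes refl with refl ← trans (sym (update-same (A number) c (suc n))) eq =
        ≤-refl , update-same (A queue) n c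
      ... | no c≢d =
        let i<n , q≡d = queue-number (trans (sym (update-other (A number) (suc n) c≢d)) eq)
        in m<n⇒m<1+n i<n , trans (old i<n) q≡d

    module Exploration
      (bound : ℕ) (valid⇒< : ∀ {c} → Valid c → c < bound)
      (vertex-valid : ∀ {c} → c < vertexCount → Valid c)
      (row-valid : ∀ {c d} → Valid c → d ∈ row c → Valid d)
      where

      record Initial (k : ℕ) (s : Store) : Set where
        field
          length-≡  : regs s queueLength ≡ k
          no-output : output s ≡ []
          scan      : Scan (arrs s) (regs s queueLength)
          queue-id  : ∀ {i} → i < regs s queueLength → arrs s queue i ≡ i

      enqueueVertices-reaches :
        Reaches input enqueueVertices initial (1 + sumTo (λ _ → 5) vertexCount) (Initial vertexCount)
      enqueueVertices-reaches = whileNZ-count Initial (λ _ → 4) vertexCount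
        (λ k< i → step k< i)
        (λ i → trans (cong (vertexCount ∸_) (Initial.length-≡ i)) (n∸n≡0 vertexCount))
        record
          { length-≡ = refl ; no-output = refl ; queue-id = λ ()
          ; scan = record { valid = λ () ; number-queue = λ () ; queue-number = λ ()
                          ; seen-sound = λ 0≢0 → contradiction refl 0≢0 ; queue-seen = λ () } }
        where
        step : ∀ {k s} → k < vertexCount → Initial k s →
          vertexCount ∸ regs s queueLength ≢ 0 ×
          Reaches input (symbol ≔ reg queueLength ⨾ enqueue) s 4 (Initial (suc k))
        step {k} {s} k< i@record { length-≡ = refl } =
          m>n⇒m∸n≢0 k< , _ , _ , assign ⨾ write ⨾ write ⨾ assign , ≤-refl , record
            { length-≡  = refl
            ; no-output = no-output
            ; scan      = Scan-enqueued scan (vertex-valid k<) unnumbered (inj₁ k<)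
            ; queue-id  = λ j< → identity (m<1+n⇒m<n∨m≡n j<)
            }
          where
          open Initial i
          n = regs s queueLength
          -- A number `suc j` would place `n` at position `j < n` of the queue, which holds `j` by
          -- `queue-id`.
          unnumbered : arrs s number n ≡ 0
          unnumbered with arrs s number n in eq
          ... | zero  = refl
          ... | suc j = let j<n , q≡n = Scan.queue-number scan eq in
            contradiction (trans (sym (queue-id j<n)) q≡n) (<⇒≢ j<n)
          identity : ∀ {j} → j < n ⊎ j ≡ n → update (arrs s queue) n n j ≡ j
          identity (inj₁ j<n)  = trans (queue-≡ (Extends-enqueued {arrs s} n) j<n) (queue-id j<n)
          identity (inj₂ refl) = update-same (arrs s queue) n n

      record Scanning (s₀ : Store) (k : ℕ) (s : Store) : Set where
        field
          position-≡ : regs s position ≡ regs s₀ position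
          column-≡   : regs s column ≡ k
          no-output  : output s ≡ []
          scan       : Scan (arrs s) (regs s queueLength)
          extends    : Extends (arrs s₀) (regs s₀ queueLength) (arrs s) (regs s queueLength)
          good       : ∀ {i} → i < k →
                       Good (arrs s) (lookupOr 0 (row (arrs s₀ queue (regs s₀ position))) i)

      -- The store `s₀` from before the scan fixes which row is read. The queue may grow meanwhile,
      -- but the position lies in the part that `Extends` preserves, so the row stays the same.
      scanRow-reaches : ∀ {s₀ s} → regs s₀ position < regs s₀ queueLength →
        let len = length (row (arrs s₀ queue (regs s₀ position))) in
        Scanning s₀ 0 s → Reaches input scanRow s (1 + sumTo (λ _ → 8) len) (Scanning s₀ len)
      -- A round takes at most 7 steps: 2 to read and mark the letter, 4 for the test and the three
      -- instructions of `enqueue`, 1 to advance `column`.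
      scanRow-reaches {s₀} {s} h<n = whileNZ-count (Scanning s₀) (λ _ → 7) (length r) step
        (λ i → trans (cong₂ _∸_ (cong length (row-≡ i)) (Scanning.column-≡ i)) (n∸n≡0 (length r)))
        where
        x = arrs s₀ queue (regs s₀ position)
        r = row x

        row-≡ : ∀ {k s} → Scanning s₀ k s → row (arrs s queue (regs s position)) ≡ r
        row-≡ {s = s} i = cong row (trans (cong (arrs s queue) position-≡) (queue-≡ extends h<n))
          where open Scanning i

        step : ∀ {k s} → k < length r → Scanning s₀ k s →
          value input (rowLength symbolRow ⊖ reg column) s ≢ 0 ×
          Reaches input
            ( symbol ≔ entry symbolRow (reg column)
            ⨾ seen [ reg symbol ]≔ lit 1
            ⨾ ifNZ (arr number (reg symbol)) skip enqueue
            ⨾ increment column) s 7 (Scanning s₀ (suc k))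
        step {k} {s} k< i@record { column-≡ = refl } = test , visit
          where
          open Scanning i
          A = arrs s
          n = regs s queueLength
          h = regs s position
          c = lookupOr 0 (row (A queue h)) k

          k<row : k < length (row (A queue h))
          k<row = subst (λ l → k < length l) (sym (row-≡ i)) k<

          test : length (row (A queue h)) ∸ k ≢ 0
          test = m>n⇒m∸n≢0 k<row

          h<m : h < n
          h<m = subst (_< n) (sym position-≡) (<-≤-trans h<n (length-≤ extends))

          c∈ : c ∈ row (A queue h)
          c∈ = lookupOr∈ 0 k<row

          scan′ : Scan (markSeen A c) n
          scan′ = Scan-markSeen scan h<m c∈

          c-seen : markSeen A c seen c ≢ 0
          c-seen eq = 1+n≢0 (trans (sym (update-same (A seen) c 1)) eq)

          good′ : ∀ {B m} → Extends (markSeen A c) n B m → Good B c →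
            ∀ {j} → j < suc k → Good B (lookupOr 0 r j)
          good′ {B} ext c-good j< with m<1+n⇒m<n∨m≡n j<
          ... | inj₁ j<k  = good-kept (Extends-trans (Extends-markSeen c) ext) (good j<k)
          ... | inj₂ refl = subst (λ l → Good B (lookupOr 0 l k)) (row-≡ i) c-good

          visit : Reaches input
            ( symbol ≔ entry symbolRow (reg column)
            ⨾ seen [ reg symbol ]≔ lit 1
            ⨾ ifNZ (arr number (reg symbol)) skip enqueue
            ⨾ increment column) s 7 (Scanning s₀ (suc k))
          visit with A number c ≟ 0
          ... | no c≢0 = _ , _ , assign ⨾ write ⨾ if-true c≢0 skip ⨾ assign , m≤m+n 5 2 , record
            { position-≡ = position-≡
            ; column-≡   = refl
            ; no-output  = no-output
            ; scan       = scan′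
            ; extends    = Extends-trans extends (Extends-markSeen c)
            ; good       = good′ Extends-refl (c≢0 , c-seen)
            }
          ... | yes c≡0 = _ , _ , assign ⨾ write ⨾ if-false c≡0 (write ⨾ write ⨾ assign) ⨾ assign ,
            ≤-refl , record
            { position-≡ = position-≡
            ; column-≡   = refl
            ; no-output  = no-output
            ; scan       = Scan-enqueued scan′ (row-valid (Scan.valid scan h<m) c∈) c≡0 (inj₂ c-seen)
            ; extends    = Extends-trans extends
                             (Extends-trans (Extends-markSeen c) (Extends-enqueued c))
            ; good       = good′ (Extends-enqueued c)
                ( (λ eq → 1+n≢0 (trans (sym (update-same (A number) c (suc n))) eq))
                , c-seen )
            }

      record Explored (h : ℕ) (s : Store) : Set where
        field
          no-output   : output s ≡ []
          scan        : Scan (arrs s) (regs s queueLength)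
          vertices-≤  : vertexCount ≤ regs s queueLength
          vertices    : ∀ {c} → c < vertexCount → arrs s number c ≢ 0
          closed      : ∀ {i c} → i < h → c ∈ row (arrs s queue i) → Good (arrs s) c

      -- A queue entry is charged 4 for the outer test, the reset of `column`, the failing test of
      -- `scanRow` and the advance of `position`, and 8 for each letter of its row. The charge
      -- depends only on the first `h` entries, so it survives the growth of the queue.
      exploreCost : (ℕ → ℕ) → ℕ → ℕ
      exploreCost q h = sumTo (λ i → 4 + 8 * length (row (q i))) h

      queueLength≤bound : ∀ {A n} → Scan A n → n ≤ bound
      queueLength≤bound scan = ≤-trans
        (injective⇒≤length (Scan.queue-injective scan) (λ i< → ∈-upTo⁺ (valid⇒< (Scan.valid scan i<))))
        (≤-reflexive (length-upTo bound))

      exploreCost-step : ∀ {A n B m} h → h < n → Extends A n B m →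
        exploreCost (B queue) (suc h) ≡ exploreCost (A queue) h + (4 + 8 * length (row (A queue h)))
      exploreCost-step {A} {B = B} h h<n ext = trans
        (sumTo-suc (λ i → 4 + 8 * length (row (B queue i))) h)
        (cong₂ _+_ (sumTo-cong h (λ i<h → cost-≡ (<-trans i<h h<n))) (cost-≡ h<n))
        where
        cost-≡ : ∀ {i} → i < _ → 4 + 8 * length (row (B queue i)) ≡ 4 + 8 * length (row (A queue i))
        cost-≡ i<n = cong (λ x → 4 + 8 * length (row x)) (queue-≡ ext i<n)

      advance-reaches : ∀ {s} → let h = regs s position in
        h < regs s queueLength → Explored h s →
        Reaches input (column ≔ lit 0 ⨾ scanRow ⨾ increment position) s
          (3 + 8 * length (row (arrs s queue h)))
          (λ s′ → regs s′ position ≡ suc h × Explored (suc h) s′ ×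
                  Extends (arrs s) (regs s queueLength) (arrs s′) (regs s′ queueLength))
      advance-reaches {s} h<n ex =
        let s′ , t , run , t≤ , i = scanRow-reaches {s} {record s { regs = update (regs s) column 0 }}
              h<n record
              { position-≡ = refl ; column-≡ = refl ; no-output = Explored.no-output ex
              ; scan = Explored.scan ex ; extends = Extends-refl ; good = λ () }
            open Scanning i using (position-≡; extends; good)
        in record s′ { regs = update (regs s′) position (suc (regs s′ position)) } , _ ,
           assign ⨾ run ⨾ assign ,
           time t≤ ,
           cong suc position-≡ ,
           record
             { no-output  = Scanning.no-output i
             ; scan       = Scanning.scan i
             ; vertices-≤ = ≤-trans vertices-≤ (length-≤ extends)
             ; vertices   = number-kept extends ∘ vertices
             ; closed     = λ j< c∈ → closed′ extends good (m<1+n⇒m<n∨m≡n j<) c∈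
             } ,
           extends
        where
        open Explored ex
        len = length (row (arrs s queue (regs s position)))

        time : ∀ {t} → t ≤ 1 + sumTo (λ _ → 8) len → 1 + (t + 1) ≤ 3 + 8 * len
        time {t} t≤ = begin
          1 + (t + 1)                          ≡⟨ cong suc (+-comm t 1) ⟩
          2 + t                                ≤⟨ +-monoʳ-≤ 2 t≤ ⟩
          3 + sumTo (λ _ → 8) len              ≡⟨ cong (3 +_) (sumTo-const 8 len) ⟩
          3 + len * 8                          ≡⟨ cong (3 +_) (*-comm len 8) ⟩
          3 + 8 * len                          ∎
          where open ≤-Reasoning

        closed′ : ∀ {B m} → Extends (arrs s) (regs s queueLength) B m →
          (∀ {i} → i < len → Good B (lookupOr 0 (row (arrs s queue (regs s position))) i)) →
          ∀ {j c} → j < regs s position ⊎ j ≡ regs s position → c ∈ row (B queue j) → Good B c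
        closed′ ext good (inj₁ j<h) c∈ =
          good-kept ext (closed j<h (subst (λ x → _ ∈ row x) (queue-≡ ext (<-trans j<h h<n)) c∈))
        closed′ {B} ext good (inj₂ refl) c∈ =
          let i , i< , eq = ∈⇒lookupOr 0 (subst (λ x → _ ∈ row x) (queue-≡ ext h<n) c∈)
          in subst (Good B) eq (good i<)

      -- The queue grows while it is read, so the number of rounds is not known beforehand and
      -- `whileNZ-count` does not apply. `fuel` serves termination only: the queue holds distinct
      -- codes below `bound`. Time is amortised instead, with `exploreCost` as potential: its value
      -- at the present position plus the time still needed is at most its value at the final queue
      -- plus the failing test.
      explore-reaches : ∀ fuel {s} → bound ≤ fuel + regs s position →
        regs s position ≤ regs s queueLength → Explored (regs s position) s →
        Σ[ s′ ∈ Store ] Σ[ t ∈ ℕ ] (Run input explore s t s′ ×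
          exploreCost (arrs s queue) (regs s position) + t
            ≤ exploreCost (arrs s′ queue) (regs s′ queueLength) + 1 ×
          Explored (regs s′ queueLength) s′)
      explore-reaches fuel {s} b≤ h≤n ex with m≤n⇒m<n∨m≡n h≤n
      ... | inj₂ h≡n = s , 1 ,
        while-stop (trans (cong (_∸ regs s position) (sym h≡n)) (n∸n≡0 (regs s position))) ,
        ≤-reflexive (cong (λ h → exploreCost (arrs s queue) h + 1) h≡n) ,
        subst (λ h → Explored h s) h≡n ex
      explore-reaches zero {s} b≤ h≤n ex | inj₁ h<n =
        contradiction (<-≤-trans h<n (≤-trans (queueLength≤bound (Explored.scan ex)) b≤)) (<-irrefl refl)
      explore-reaches (suc fuel) {s} b≤ h≤n ex | inj₁ h<n
        with s₁ , t , run , t≤ , pos-≡ , ex₁ , ext ← advance-reaches h<n ex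
        with s₂ , u , run′ , u≤ , ex₂ ← explore-reaches fuel {s₁}
               (subst (bound ≤_) (trans (sym (+-suc fuel _)) (cong (fuel +_) (sym pos-≡))) b≤)
               (subst (_≤ regs s₁ queueLength) (sym pos-≡) (<-≤-trans h<n (length-≤ ext)))
               (subst (λ h → Explored h s₁) (sym pos-≡) ex₁)
        = s₂ , _ , while-step (m>n⇒m∸n≢0 h<n) run run′ , time , ex₂
        where
        h = regs s position
        time : exploreCost (arrs s queue) h + suc (t + u)
             ≤ exploreCost (arrs s₂ queue) (regs s₂ queueLength) + 1
        time = begin
          exploreCost (arrs s queue) h + (suc t + u)
            ≡⟨ +-assoc (exploreCost (arrs s queue) h) (suc t) u ⟨
          exploreCost (arrs s queue) h + suc t + u
            ≤⟨ +-monoˡ-≤ u (+-monoʳ-≤ (exploreCost (arrs s queue) h) (s≤s t≤)) ⟩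
          exploreCost (arrs s queue) h + (4 + 8 * length (row (arrs s queue h))) + u
            ≡⟨ cong (_+ u) (exploreCost-step h h<n ext) ⟨
          exploreCost (arrs s₁ queue) (suc h) + u
            ≡⟨ cong (λ k → exploreCost (arrs s₁ queue) k + u) pos-≡ ⟨
          exploreCost (arrs s₁ queue) (regs s₁ position) + u
            ≤⟨ u≤ ⟩
          exploreCost (arrs s₂ queue) (regs s₂ queueLength) + 1 ∎
          where open ≤-Reasoning

      Initial-numbered : ∀ {c k s} → Initial k s → c < regs s queueLength → arrs s number c ≢ 0
      Initial-numbered {c} {s = s} i c<n eq = 0≢1+n (trans (sym eq)
        (trans (cong (arrs s number) (sym (Initial.queue-id i c<n)))
               (Scan.number-queue (Initial.scan i) c<n)))

      search-reaches : Σ[ s ∈ Store ] Σ[ t ∈ ℕ ] (Run input search initial t s ×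
        t ≤ 3 + (5 * vertexCount + exploreCost (arrs s queue) (regs s queueLength)) ×
        Explored (regs s queueLength) s)
      search-reaches
        with s₀ , t , run , t≤ , i@record { length-≡ = n≡V } ← enqueueVertices-reaches
        with s₁ , u , run′ , u≤ , ex ← explore-reaches bound
               {record s₀ { regs = update (regs s₀) position 0 }}
               (≤-reflexive (sym (+-identityʳ bound))) z≤n record
               { no-output  = Initial.no-output i
               ; scan       = Initial.scan i
               ; vertices-≤ = ≤-reflexive (sym n≡V)
               ; vertices   = λ {c} c<V → Initial-numbered i (subst (c <_) (sym n≡V) c<V)
               ; closed     = λ ()
               }
        = s₁ , _ , run ⨾ assign ⨾ run′ , time , ex
        where
        time : t + (1 + u) ≤ 3 + (5 * vertexCount + exploreCost (arrs s₁ queue) (regs s₁ queueLength))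
        time = begin
          t + (1 + u)
            ≤⟨ +-mono-≤ t≤ (s≤s u≤) ⟩
          (1 + sumTo (λ _ → 5) vertexCount) + (1 + (cost + 1))
            ≡⟨ cong (λ x → 1 + x + (1 + (cost + 1)))
                (trans (sumTo-const 5 vertexCount) (*-comm vertexCount 5)) ⟩
          (1 + 5 * vertexCount) + (1 + (cost + 1))
            ≡⟨ solve 2 (λ x y → (con 1 :+ x) :+ (con 1 :+ (y :+ con 1)) := con 3 :+ (x :+ y))
                 refl (5 * vertexCount) cost ⟩
          3 + (5 * vertexCount + cost) ∎
          where
          open ≤-Reasoning
          open +-*-Solver
          cost = exploreCost (arrs s₁ queue) (regs s₁ queueLength)

-- Writing the grammar

emitRow : Program
emitRow = whileNZ (rowLength symbolRow ⊖ reg column)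
  ( emit (lit 3)
  ⨾ emit (arr number (entry symbolRow (reg column)))
  ⨾ increment column)

-- Nodes have exactly the codes below the number of nodes, where truncated subtraction is non-zero.
ifVertex : Program → Program
ifVertex p = ifNZ (entry (lit 0) (lit 0) ⊖ arr queue (reg position)) p skip

-- Polish notation has no closing marks, so the nested applications of a word are written in one
-- pass over its letters. The rules of the two kinds of symbols differ only by the guarded pieces:
-- the label in front, and the `□` that ends the left child. The final two zeros encode the
-- parameter.
emitRule : Program
emitRule = ifVertex (emit (lit 2) ⨾ emit (entry (lit 1) (arr queue (reg position))))
         ⨾ column ≔ lit 0
         ⨾ emitRow
         ⨾ ifVertex (emit (lit 1))
         ⨾ emit (lit 0)
         ⨾ emit (lit 0)
         ⨾ increment position

emitRules : Program
emitRules = whileNZ (reg queueLength ⊖ reg position) emitRule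

emitRanks : Program
emitRanks = whileNZ (reg queueLength ⊖ reg position) (emit (lit 1) ⨾ increment position)

emitHeader : Program
emitHeader = emit (lit 1 ⊕ reg queueLength)
           ⨾ emit (lit 0)
           ⨾ emit (lit 0)
           ⨾ position ≔ lit 0

emitStartRule : Program
emitStartRule = emit (lit 3)
              ⨾ emit (arr number (reg vertex))
              ⨾ emit (lit 1)
              ⨾ position ≔ lit 0

emitGrammar : Program
emitGrammar = emitHeader ⨾ emitRanks ⨾ emitStartRule ⨾ emitRules

module Emission (input : Input) where
  open Search input

  onlyIfVertex : ℕ → List ℕ → List ℕ
  onlyIfVertex c xs with vertexCount ∸ c
  ... | zero  = []
  ... | suc _ = xs

  reference : (Arr → ℕ → ℕ) → ℕ → List ℕ
  reference A d = 3 ∷ A number d ∷ []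

  ruleCode : (Arr → ℕ → ℕ) → ℕ → List ℕ
  ruleCode A c = onlyIfVertex c (2 ∷ lookupOr 0 (lookupOr [] input 1) c ∷ [])
              ++ concatMap (reference A) (row c)
              ++ onlyIfVertex c [ 1 ]
              ++ 0 ∷ 0 ∷ []

  -- The constant ranks are written as a `concatMap` over the queue so that both output loops are
  -- instances of `whileQueued`.
  grammarCode : (Arr → ℕ → ℕ) → ℕ → ℕ → List ℕ
  grammarCode A n r = suc n ∷ 0 ∷ 0 ∷ concatMap (λ _ → [ 1 ]) (applyUpTo (A queue) n)
                   ++ 3 ∷ A number r ∷ 1 ∷ concatMap (ruleCode A) (applyUpTo (A queue) n)

  -- What the output loops leave unchanged, as equations with variables: matching them with `refl`
  -- makes the conditions on the next store hold by computation.
  record Frame (A : Arr → ℕ → ℕ) (n r h : ℕ) (s : Store) : Set where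
    constructor frame
    field
      arrs-≡     : arrs s ≡ A
      length-≡   : regs s queueLength ≡ n
      vertex-≡   : regs s vertex ≡ r
      position-≡ : regs s position ≡ h

  emitRow-step : ∀ {A n r h out k s rest} → k < length (row (A queue h)) →
    Frame A n r h s × regs s column ≡ k →
    Remaining out (reference A (lookupOr 0 (row (A queue h)) k) ++ rest) s →
    value input (rowLength symbolRow ⊖ reg column) s ≢ 0 ×
    Reaches input (emit (lit 3) ⨾ emit (arr number (entry symbolRow (reg column))) ⨾ increment column)
      s 3 (λ s′ → (Frame A n r h s′ × regs s′ column ≡ suc k) × Remaining out rest s′)
  emitRow-step {s = s} k< (frame refl refl refl refl , refl) rem =
    m>n⇒m∸n≢0 k< , _ , _ , emit ⨾ emit ⨾ assign , ≤-refl ,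
    (frame refl refl refl refl , refl) , emit-next (emit-next {output s} rem)

  emitRow-reaches : ∀ {A n r h out s rest} → Frame A n r h s → regs s column ≡ 0 →
    Remaining out (concatMap (reference A) (row (A queue h)) ++ rest) s →
    Reaches input emitRow s (1 + sumTo (λ _ → 4) (length (row (A queue h))))
      (λ s′ → Frame A n r h s′ × Remaining out rest s′)
  emitRow-reaches {A} {n} {r} {h} fr col rem =
    let s′ , t , run , t≤ , (fr′ , _) , rem′ = emit-each
          (λ k s → Frame A n r h s × regs s column ≡ k) (λ _ → 3) (row (A queue h)) (reference A)
          (λ k< → emitRow-step k<)
          (λ { (frame refl refl refl refl , col) →
               trans (cong (length (row (A queue h)) ∸_) col) (n∸n≡0 (length (row (A queue h)))) })
          (fr , col) rem
    in s′ , t , run , t≤ , fr′ , rem′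

  -- The bound of the guarded program has the form `suc b` so that it also covers the single step of
  -- `skip` in the other branch.
  ifVertex-reaches : ∀ {A n r h out s rest p xs b} → Frame A n r h s →
    (∀ {rest} → Remaining out (xs ++ rest) s →
      Reaches input p s (suc b) (λ s′ → Frame A n r h s′ × Remaining out rest s′)) →
    Remaining out (onlyIfVertex (A queue h) xs ++ rest) s →
    Reaches input (ifVertex p) s (2 + b) (λ s′ → Frame A n r h s′ × Remaining out rest s′)
  ifVertex-reaches {A} {h = h} fr@(frame refl refl refl refl) f rem
    with vertexCount ∸ A queue h in eq
  ... | zero  = _ , _ , if-false eq skip , s≤s (s≤s z≤n) , fr , rem
  ... | suc _ = let s′ , t , run , t≤ , q = f rem in
    s′ , _ , if-true (λ eq′ → 1+n≢0 (trans (sym eq) eq′)) run , s≤s t≤ , q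

  emitRule-reaches : ∀ {A n r h out s rest} → Frame A n r h s →
    Remaining out (ruleCode A (A queue h) ++ rest) s →
    Reaches input emitRule s (10 + 4 * length (row (A queue h)))
      (λ s′ → Frame A n r (suc h) s′ × Remaining out rest s′)
  emitRule-reaches {A} {n} {r} {h} {out} {s} {rest} fr rem = weaken time
    (ifVertex-reaches {b = 1} fr
       (λ { {rest} rem → _ , _ , emit ⨾ emit , ≤-refl , keep fr ,
            emit-next (emit-next {output s} (labelled fr rem)) })
       (subst (λ l → Remaining out l s) assoc rem)
     then λ (fr₁ , rem₁) → resetColumn fr₁ rem₁
     then λ (fr₂ , col , rem₂) → emitRow-reaches fr₂ col rem₂
     then λ {s₃} (fr₃ , rem₃) →
       ifVertex-reaches {b = 0} fr₃
         (λ rem → _ , _ , emit , ≤-refl , keep fr₃ , emit-next {output s₃} rem) rem₃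
     then λ {s₄} (fr₄ , rem₄) →
       _ , _ , emit ⨾ emit ⨾ assign , ≤-refl {3} , next fr₄ , emit-next (emit-next {output s₄} rem₄))
    where
    keep : ∀ {h s o} → Frame A n r h s → Frame A n r h (record s { output = o })
    keep (frame refl refl refl refl) = frame refl refl refl refl

    resetColumn : ∀ {h s rest} → Frame A n r h s → Remaining out rest s →
      Reaches input (column ≔ lit 0) s 1
        (λ s′ → Frame A n r h s′ × regs s′ column ≡ 0 × Remaining out rest s′)
    resetColumn (frame refl refl refl refl) rem =
      _ , _ , assign , ≤-refl , frame refl refl refl refl , refl , rem

    next : ∀ {h s o} → Frame A n r h s →
      Frame A n r (suc h) (record s { regs = update (regs s) position (suc (regs s position)) ; output = o })
    next (frame refl refl refl refl) = frame refl refl refl refl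

    labelled : ∀ {s rest} → Frame A n r h s →
      Remaining out (2 ∷ lookupOr 0 (lookupOr [] input 1) (A queue h) ∷ rest) s →
      Remaining out (2 ∷ lookupOr 0 (lookupOr [] input 1) (arrs s queue (regs s position)) ∷ rest) s
    labelled (frame refl refl refl refl) rem = rem

    c = A queue h
    front = onlyIfVertex c (2 ∷ lookupOr 0 (lookupOr [] input 1) c ∷ [])
    middle = concatMap (reference A) (row c)

    assoc : ruleCode A c ++ rest ≡ front ++ middle ++ onlyIfVertex c [ 1 ] ++ 0 ∷ 0 ∷ rest
    assoc = trans (++-assoc front _ rest) (cong (front ++_)
      (trans (++-assoc middle _ rest) (cong (middle ++_)
        (++-assoc (onlyIfVertex c [ 1 ]) (0 ∷ 0 ∷ []) rest))))

    len = length (row c)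

    time : 3 + (1 + ((1 + sumTo (λ _ → 4) len) + (2 + 3))) ≤ 10 + 4 * len
    time = ≤-reflexive (trans
      (cong (λ x → 3 + (1 + ((1 + x) + (2 + 3)))) (trans (sumTo-const 4 len) (*-comm len 4)))
      (cong (5 +_) (+-comm (4 * len) 5)))

  whileQueued : ∀ {A n r out s rest p} cost g →
    (∀ {h s rest} → Frame A n r h s → Remaining out (g (A queue h) ++ rest) s →
      Reaches input p s (cost h) (λ s′ → Frame A n r (suc h) s′ × Remaining out rest s′)) →
    Frame A n r 0 s → Remaining out (concatMap g (applyUpTo (A queue) n) ++ rest) s →
    Reaches input (whileNZ (reg queueLength ⊖ reg position) p) s (1 + sumTo (suc ∘ cost) n)
      (λ s′ → Frame A n r n s′ × Remaining out rest s′)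
  whileQueued {A} {n} {r} {out} {s} {rest} {p} cost g step fr rem =
    subst (λ l → Reaches input (whileNZ (reg queueLength ⊖ reg position) p) s
                   (1 + sumTo (suc ∘ cost) l) (λ s′ → Frame A n r l s′ × Remaining out rest s′))
      (length-applyUpTo (A queue) n)
      (emit-each (Frame A n r) cost (applyUpTo (A queue) n) g
        (λ {k} {s} {rest} k< fr rem →
          let k<n = subst (k <_) (length-applyUpTo (A queue) n) k< in
          test fr k<n ,
          step fr (subst (λ c → Remaining out (g c ++ rest) s) (lookupOr-applyUpTo 0 (A queue) k<n) rem))
        (λ fr → trans (cong₂ _∸_ (Frame.length-≡ fr)
                  (trans (Frame.position-≡ fr) (length-applyUpTo (A queue) n))) (n∸n≡0 n))
        fr rem)
    where
    test : ∀ {k s} → Frame A n r k s → k < n → regs s queueLength ∸ regs s position ≢ 0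
    test (frame refl refl refl refl) = m>n⇒m∸n≢0

  emitGrammar-reaches : ∀ {A n r h s} → Frame A n r h s → output s ≡ [] →
    Reaches input emitGrammar s
      (10 + (3 * n + sumTo (λ i → 11 + 4 * length (row (A queue i))) n))
      (λ s′ → output s′ ≡ grammarCode A n r)
  emitGrammar-reaches {A} {n} {r} {s = s} fr no-output = weaken time
    (header fr no-output
     then λ (fr₁ , rem₁) → whileQueued (λ _ → 2) (λ _ → [ 1 ]) rank-step fr₁ rem₁
     then λ (fr₂ , rem₂) → startRule fr₂ rem₂
     then λ (fr₃ , rem₃) → finish
       (whileQueued (λ h → 10 + 4 * length (row (A queue h))) (ruleCode A) emitRule-reaches fr₃ rem₃))
    where
    out = grammarCode A n r
    ranks = concatMap (λ _ → [ 1 ]) (applyUpTo (A queue) n)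
    rules = concatMap (ruleCode A) (applyUpTo (A queue) n)

    header : ∀ {h s} → Frame A n r h s → output s ≡ [] → Reaches input emitHeader s 4
      (λ s′ → Frame A n r 0 s′ × Remaining out (ranks ++ 3 ∷ A number r ∷ 1 ∷ rules) s′)
    header (frame refl refl refl refl) no-output = _ , _ , emit ⨾ emit ⨾ emit ⨾ assign , ≤-refl ,
      frame refl refl refl refl ,
      cong (λ o → (((o ++ [ suc n ]) ++ [ 0 ]) ++ [ 0 ]) ++ ranks ++ 3 ∷ A number r ∷ 1 ∷ rules) no-output

    rank-step : ∀ {h s rest} → Frame A n r h s → Remaining out (1 ∷ rest) s →
      Reaches input (emit (lit 1) ⨾ increment position) s 2
        (λ s′ → Frame A n r (suc h) s′ × Remaining out rest s′)
    rank-step {s = s} (frame refl refl refl refl) rem =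
      _ , _ , emit ⨾ assign , ≤-refl , frame refl refl refl refl , emit-next {output s} rem

    startRule : ∀ {h s} → Frame A n r h s → Remaining out (3 ∷ A number r ∷ 1 ∷ rules) s →
      Reaches input emitStartRule s 4 (λ s′ → Frame A n r 0 s′ × Remaining out (rules ++ []) s′)
    startRule {s = s} (frame refl refl refl refl) rem =
      _ , _ , emit ⨾ emit ⨾ emit ⨾ assign , ≤-refl , frame refl refl refl refl ,
      trans (cong (_ ++_) (++-identityʳ rules))
        (emit-next (emit-next (emit-next {output s} rem)))

    finish : ∀ {p s b} → Reaches input p s b (λ s′ → Frame A n r n s′ × Remaining out [] s′) →
      Reaches input p s b (λ s′ → output s′ ≡ out)
    finish (s′ , t , run , t≤ , _ , rem) =
      s′ , t , run , t≤ , trans (sym (++-identityʳ (output s′))) rem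

    cost = sumTo (λ i → 11 + 4 * length (row (A queue i))) n

    time : 4 + ((1 + sumTo (λ _ → 3) n) + (4 + (1 + cost))) ≤ 10 + (3 * n + cost)
    time = ≤-reflexive (trans
      (cong (λ x → 4 + ((1 + x) + (4 + (1 + cost)))) (trans (sumTo-const 3 n) (*-comm n 3)))
      (solve 2 (λ x y → con 4 :+ ((con 1 :+ x) :+ (con 4 :+ (con 1 :+ y))) := con 10 :+ (x :+ y))
        refl (3 * n) cost))
      where open +-*-Solver

-- Correctness of the translation

translate : Program
translate = search ⨾ findRoot ⨾ emitGrammar

findRoot-reaches : ∀ {input r s} → arrs s seen r ≡ 0 → (∀ {c} → c < r → arrs s seen c ≢ 0) →
  output s ≡ [] → Reaches input findRoot s (1 + (1 + sumTo (λ _ → 2) r))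
    (λ s′ → Emission.Frame input (arrs s) (regs s queueLength) r (regs s position) s′ × output s′ ≡ [])
findRoot-reaches {input} {r} {s₀} r-unseen seen-below no-output =
  (_ , _ , assign , ≤-refl , frame refl refl refl refl , no-output)
  then whileNZ-count I (λ _ → 1) r step
    (λ (fr , _) → trans (cong₂ (λ A → A seen) (Frame.arrs-≡ fr) (Frame.vertex-≡ fr)) r-unseen)
  where
  open Emission input
  I : ℕ → Store → Set
  I k s = Frame (arrs s₀) (regs s₀ queueLength) k (regs s₀ position) s × output s ≡ []
  step : ∀ {k s} → k < r → I k s → arrs s seen (regs s vertex) ≢ 0 ×
    Reaches input (increment vertex) s 1 (I (suc k))
  step k<r (frame a l v p , o) =
    subst (_≢ 0) (sym (cong₂ (λ A → A seen) a v)) (seen-below k<r) ,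
    _ , _ , assign , ≤-refl , frame a l (cong suc v) p , o

module Correctness {σ : ℕ} (D : CompressedDag σ) where
  open CompressedDag D
  open Semantics D
  open Search (encodeDag D)
  open Emission (encodeDag D)

  -- Codes of symbols and the rows of the input table.

  code : Symbol → ℕ
  code = symbolCode D

  code-injective : ∀ {x y} → code x ≡ code y → x ≡ y
  code-injective {inj₁ X} {inj₁ Y} eq = cong inj₁ (toℕ-injective (+-cancelˡ-≡ V _ _ eq))
  code-injective {inj₁ X} {inj₂ v} eq =
    contradiction (toℕ<n v) (≤⇒≯ (≤-trans (m≤m+n V (toℕ X)) (≤-reflexive eq)))
  code-injective {inj₂ v} {inj₁ X} eq =
    contradiction (toℕ<n v) (≤⇒≯ (≤-trans (m≤m+n V (toℕ X)) (≤-reflexive (sym eq))))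
  code-injective {inj₂ v} {inj₂ w} eq = cong inj₂ (toℕ-injective eq)

  code<V+N : ∀ x → code x < V + N
  code<V+N (inj₁ X) = +-monoʳ-< V (toℕ<n X)
  code<V+N (inj₂ v) = <-≤-trans (toℕ<n v) (m≤m+n V N)

  row-code : ∀ x → row (code x) ≡ map code (body x)
  row-code (inj₁ X) = trans
    (lookupOr-tabulate-++ʳ [] (λ v → map code (γ v)) _ (toℕ X))
    -- The rows of the nonterminals end the table; appending `[]` gives them the shape of the lookup
    -- lemma.
    (trans (cong (λ l → lookupOr [] l (toℕ X)) (sym (++-identityʳ (tabulate (λ X → map code (ρ X))))))
           (lookupOr-tabulate-++ˡ [] (λ X → map code (ρ X)) [] X))
  row-code (inj₂ v) = lookupOr-tabulate-++ˡ [] (λ v → map code (γ v)) _ v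

  length-row-code : ∀ x → length (row (code x)) ≡ length (body x)
  length-row-code x = trans (cong length (row-code x)) (length-map code (body x))

  code∈row : ∀ x {y} → y ∈ body x → code y ∈ row (code x)
  code∈row x {y} y∈ = subst (code y ∈_) (sym (row-code x)) (∈-map⁺ code y∈)

  ∈row⇒∈body : ∀ {x c} → c ∈ row (code x) → Σ[ y ∈ Symbol ] (y ∈ body x × c ≡ code y)
  ∈row⇒∈body {x} c∈ = ∈-map⁻ code (subst (_ ∈_) (row-code x) c∈)

  sizeDag≡sumTo : sumTo (length ∘ row) (V + N) ≡ sizeDag D
  sizeDag≡sumTo = begin
    sumTo (length ∘ row) (V + N)
      ≡⟨ sumTo-+ (length ∘ row) V N ⟩
    sumTo (length ∘ row) V + sumTo (length ∘ row ∘ (V +_)) N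
      ≡⟨ cong₂ (λ xs ys → sum xs + sum ys)
           (tabulate≡applyUpTo (length ∘ row) (λ v → sym (length-row-code (inj₂ v))))
           (tabulate≡applyUpTo (length ∘ row ∘ (V +_)) (λ X → sym (length-row-code (inj₁ X)))) ⟨
    sum (tabulate (λ v → length (γ v))) + sizeSL G
      ≡⟨ +-comm _ (sizeSL G) ⟩
    sizeDag D ∎
    where open ≡-Reasoning

  -- Phrased through expansions and not through membership in some `γ u`, so that it passes from a
  -- nonterminal to the letters of its right-hand side. It fails for the root, which is a child of
  -- no node.
  Occurring : Symbol → Set
  Occurring x = Σ[ u ∈ Fin V ] (∀ {v} → v ∈ expand x → v ∈ children u)

  Reachable : Symbol → Set
  Reachable x = (Σ[ v ∈ Fin V ] x ≡ inj₂ v) ⊎ Occurring x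

  body-occurring : ∀ {x y} → Reachable x → y ∈ body x → Occurring y
  body-occurring (inj₁ (v , refl)) y∈ = v , ∈-evalWord⁺ (γ v) y∈
  body-occurring {inj₁ X} (inj₂ (u , X⊆)) y∈ = u , λ v∈ →
    X⊆ (subst (_ ∈_) (sym (expand-nonterminal X)) (∈-evalWord⁺ (ρ X) y∈ v∈))
  body-occurring {inj₂ v} (inj₂ _) y∈ = v , ∈-evalWord⁺ (γ v) y∈

  Valid : ℕ → Set
  Valid c = Σ[ x ∈ Symbol ] (code x ≡ c × Reachable x)

  valid⇒< : ∀ {c} → Valid c → c < V + N
  valid⇒< (x , refl , _) = code<V+N x

  vertexOf : ∀ {c} → c < V → Σ[ v ∈ Fin V ] toℕ v ≡ c
  vertexOf c<V = fromℕ< c<V , toℕ-fromℕ< c<V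

  vertex-valid : ∀ {c} → c < V → Valid c
  vertex-valid c<V = let v , eq = vertexOf c<V in inj₂ v , eq , inj₁ (v , refl)

  row-valid : ∀ {c d} → Valid c → d ∈ row c → Valid d
  row-valid (x , refl , rx) d∈ =
    let y , y∈ , d≡ = ∈row⇒∈body {x} d∈ in y , sym d≡ , inj₂ (body-occurring rx y∈)

  open Exploration Valid (V + N) valid⇒< vertex-valid row-valid public

  module _ {s : Store} (explored : Explored (regs s queueLength) s) where
    open Explored explored
    open Scan scan

    private
      A = arrs s
      n = regs s queueLength
      rootCode = code (inj₂ dagRoot)
      work = sumTo (λ i → length (row (A queue i))) n

    -- The numbering read off from the store after the search.

    positionOf : ∀ {c} → A number c ≢ 0 →
      Σ[ i ∈ Fin n ] (A queue (toℕ i) ≡ c × suc (toℕ i) ≡ A number c)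
    positionOf {c} c≢0 =
      let i<n , q≡c = queue-number (≢0⇒≡suc c≢0)
          toℕ≡ = toℕ-fromℕ< i<n
      in fromℕ< i<n , trans (cong (A queue) toℕ≡) q≡c , trans (cong suc toℕ≡) (sym (≢0⇒≡suc c≢0))

    root-numbered : A number rootCode ≢ 0
    root-numbered = vertices (toℕ<n dagRoot)

    -- The value at symbols that have not been numbered is irrelevant.
    index : Symbol → Fin n
    index x with A number (code x) ≟ 0
    ... | yes _  = proj₁ (positionOf root-numbered)
    ... | no x≢0 = proj₁ (positionOf x≢0)

    index-spec : ∀ x → A number (code x) ≢ 0 →
      A queue (toℕ (index x)) ≡ code x × suc (toℕ (index x)) ≡ A number (code x)
    index-spec x x≢0 with A number (code x) ≟ 0
    ... | yes x≡0 = contradiction x≡0 x≢0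
    ... | no x≢0′ = proj₂ (positionOf x≢0′)

    item : Fin n → Symbol
    item i = proj₁ (valid (toℕ<n i))

    code-item : ∀ i → code (item i) ≡ A queue (toℕ i)
    code-item i = proj₁ (proj₂ (valid (toℕ<n i)))

    item-index : ∀ x → A number (code x) ≢ 0 → item (index x) ≡ x
    item-index x x≢0 = code-injective (trans (code-item (index x)) (proj₁ (index-spec x x≢0)))

    body-good : ∀ x {y} → A number (code x) ≢ 0 → y ∈ body x → Good A (code y)
    body-good x {y} x≢0 y∈ = closed (toℕ<n (index x))
      (subst (λ c → code y ∈ row c) (sym (proj₁ (index-spec x x≢0))) (code∈row x y∈))

    item-numbered : ∀ i → A number (code (item i)) ≢ 0
    item-numbered i eq = 0≢1+n
      (trans (sym eq) (trans (cong (A number) (code-item i)) (number-queue (toℕ<n i))))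

    numbering : Numbering D
    numbering = record
      { size      = n
      ; item      = item
      ; index     = index
      ; closed    = λ i {x} x∈ → item-index x (proj₁ (body-good (item i) (item-numbered i) x∈))
      ; item-root = item-index (inj₂ dagRoot) root-numbered
      }

    open Translation D numbering using (grammar; evalSLT-grammar; edges-symbolTerm; wordTerm; symbolTerm; rank)

    -- The root as the only unmarked node.

    root-unseen : A seen rootCode ≡ 0
    root-unseen with A seen rootCode ≟ 0
    ... | yes eq  = eq
    ... | no seen≢0
      with i , i<n , r∈ ← seen-sound seen≢0
      with x , x≡ , rx ← valid i<n
      with y , y∈ , r≡ ← ∈row⇒∈body {x} (subst (λ c → rootCode ∈ row c) (sym x≡) r∈)
      with refl ← code-injective {inj₂ dagRoot} {y} r≡
      with u , r⊆ ← body-occurring rx y∈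
      = contradiction (r⊆ (here refl)) (proj₁ (proj₂ (IsRootedDag.uniqueRoot isDag)) u)

    -- A node may be a child only by way of nested nonterminals. Each of them is numbered, so its
    -- row was scanned and its letters are good in turn; the descent ends at the node itself, as a
    -- marked letter.
    expand-seen : ∀ {v} x → Acc (λ y x → y ∈ body x) x → Good A (code x) → v ∈ expand x →
      A seen (toℕ v) ≢ 0
    expand-seen (inj₂ v) _ (_ , seen≢0) (here refl) = seen≢0
    expand-seen (inj₁ X) (acc rs) (X≢0 , _) v∈ =
      let y , y∈ , v∈y = ∈-evalWord⁻ (ρ X) (subst (_ ∈_) (expand-nonterminal X) v∈)
      in expand-seen y (rs y∈) (body-good (inj₁ X) X≢0 y∈) v∈y

    -- By contraposition: an unmarked node would be a child of no node, and uniqueness of the root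
    -- would identify it with `dagRoot`.
    nonroot-seen : ∀ v → dagRoot ≢ v → A seen (toℕ v) ≢ 0
    nonroot-seen v r≢v v≡0 = r≢v (proj₂ (proj₂ (IsRootedDag.uniqueRoot isDag)) λ u v∈ →
      let x , x∈ , v∈x = ∈-evalWord⁻ (γ u) v∈
      in expand-seen x (body-wellFounded x) (body-good (inj₂ u) (vertices (toℕ<n u)) x∈) v∈x v≡0)

    below-root-seen : ∀ {c} → c < toℕ dagRoot → A seen c ≢ 0
    below-root-seen c<r with v , refl ← vertexOf (<-trans c<r (toℕ<n dagRoot)) =
      nonroot-seen v (λ { refl → <-irrefl refl c<r })

    -- Length of the queue and size of the grammar.

    length≤1+work : n ≤ 1 + work
    length≤1+work = subst (λ l → n ≤ suc l) (length-concatMap-applyUpTo row (A queue) n)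
      (injective⇒≤length {xs = rootCode ∷ concatMap row (applyUpTo (A queue) n)} queue-injective
        (λ i<n → case-seen (queue-seen i<n)))
      where
      occurs : ∀ {c} → A seen c ≢ 0 → c ∈ rootCode ∷ concatMap row (applyUpTo (A queue) n)
      occurs c≢0 = let i , i<n , c∈ = seen-sound c≢0 in
        there (∈-concatMap⁺ row (lose (∈-applyUpTo⁺ (A queue) i<n) c∈))
      case-seen : ∀ {c} → c < V ⊎ A seen c ≢ 0 → c ∈ rootCode ∷ concatMap row (applyUpTo (A queue) n)
      case-seen (inj₂ c≢0) = occurs c≢0
      case-seen {c} (inj₁ c<V) with v , refl ← vertexOf c<V with rootCode ≟ c
      ... | yes r≡c = here (sym r≡c)
      ... | no r≢c  = occurs (nonroot-seen v (λ { refl → r≢c refl }))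

    work≤sizeDag : work ≤ sizeDag D
    work≤sizeDag = ≤-trans
      (sumTo-injective (length ∘ row) (A queue) n queue-injective
        (λ i<n → let x , x≡ , _ = valid i<n in subst (_< V + N) x≡ (code<V+N x)))
      (≤-reflexive sizeDag≡sumTo)

    sizeSLT-grammar : sizeSLT grammar ≤ sizeDag D + 2 * (V + N)
    sizeSLT-grammar = begin
      sizeSLT grammar
        -- The start rule has only an edge to `□` and contributes 0 by computation, so the sum runs
        -- over the queue alone. The factor `1 *` fits the shape of `sumTo-affine`.
        ≤⟨ sum-tabulate-≤ (λ i → 1 + 1 * length (row (A queue i))) (λ i → edges≤ i) ⟩
      sumTo (λ i → 1 + 1 * length (row (A queue i))) n
        ≡⟨ sumTo-affine 1 1 (λ i → length (row (A queue i))) n ⟩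
      1 * n + 1 * work
        -- The one extra edge per rule is charged to its queue entry, and distinct codes below
        -- `V + N` allow at most `V + N` entries.
        ≤⟨ +-mono-≤ (*-mono-≤ {1} {2} (s≤s z≤n) (queueLength≤bound scan))
             (≤-trans (≤-reflexive (*-identityˡ work)) work≤sizeDag) ⟩
      2 * (V + N) + sizeDag D
        ≡⟨ +-comm _ (sizeDag D) ⟩
      sizeDag D + 2 * (V + N) ∎
      where
      open ≤-Reasoning
      edges≤ : ∀ i → edges (symbolTerm (item i)) ≤ 1 + 1 * length (row (A queue (toℕ i)))
      edges≤ i = begin
        edges (symbolTerm (item i))                 ≤⟨ edges-symbolTerm (item i) ⟩
        length (body (item i)) + 1                  ≡⟨ +-comm _ 1 ⟩
        1 + length (body (item i))                  ≡⟨ cong suc (length-row-code (item i)) ⟨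
        1 + length (row (code (item i)))            ≡⟨ cong (λ c → 1 + length (row c)) (code-item i) ⟩
        1 + length (row (A queue (toℕ i)))          ≡⟨ cong suc (*-identityˡ _) ⟨
        1 + 1 * length (row (A queue (toℕ i)))      ∎

    -- The written numbers as the encoding of the grammar.

    encode-wordTerm : ∀ {k} w (e : Term σ rank k) → (∀ {x} → x ∈ w → A number (code x) ≢ 0) →
      encodeTerm (wordTerm w e) ≡ concatMap (reference A) (map code w) ++ encodeTerm e
    encode-wordTerm []      e w≢0 = refl
    encode-wordTerm (x ∷ w) e w≢0 = cong₂ (λ a l → 3 ∷ a ∷ l)
      (proj₂ (index-spec x (w≢0 (here refl))))
      (trans (++-identityʳ _) (encode-wordTerm w e (w≢0 ∘ there)))

    onlyIfVertex-vertex : ∀ v xs → onlyIfVertex (toℕ v) xs ≡ xs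
    onlyIfVertex-vertex v xs with V ∸ toℕ v in eq
    ... | zero  = contradiction eq (m>n⇒m∸n≢0 (toℕ<n v))
    ... | suc _ = refl

    onlyIfVertex-nonterminal : ∀ i xs → onlyIfVertex (V + i) xs ≡ []
    onlyIfVertex-nonterminal i xs with V ∸ (V + i) in eq
    ... | zero  = refl
    ... | suc _ = contradiction (trans (sym eq) (m≤n⇒m∸n≡0 (m≤m+n V i))) 1+n≢0

    encode-symbolTerm : ∀ x → A number (code x) ≢ 0 →
      encodeTerm (symbolTerm x) ≡ ruleCode A (code x)
    encode-symbolTerm (inj₁ X) x≢0
      rewrite onlyIfVertex-nonterminal (toℕ X) (2 ∷ lookupOr 0 (lookupOr [] (encodeDag D) 1) (V + toℕ X) ∷ [])
            | onlyIfVertex-nonterminal (toℕ X) [ 1 ]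
            | row-code (inj₁ X)
      = encode-wordTerm (ρ X) (par zero) (proj₁ ∘ body-good (inj₁ X) x≢0)
    encode-symbolTerm (inj₂ v) x≢0
      rewrite onlyIfVertex-vertex v (2 ∷ lookupOr 0 (lookupOr [] (encodeDag D) 1) (toℕ v) ∷ [])
            | onlyIfVertex-vertex v [ 1 ]
            | row-code (inj₂ v)
      = cong₂ (λ a l → 2 ∷ a ∷ l)
          (sym (trans (cong (λ l → lookupOr 0 l (toℕ v)) (sym (++-identityʳ (tabulate (toℕ ∘ label)))))
                      (lookupOr-tabulate-++ˡ 0 (toℕ ∘ label) [] v)))
          (trans (cong (_++ 0 ∷ 0 ∷ []) (encode-wordTerm (γ v) □ (proj₁ ∘ body-good (inj₂ v) x≢0)))
                 (++-assoc (concatMap (reference A) (map code (γ v))) [ 1 ] (0 ∷ 0 ∷ [])))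

    encodeSLT-grammar : encodeSLT grammar ≡ grammarCode A n rootCode
    encodeSLT-grammar = cong₂ (λ xs ys → suc n ∷ 0 ∷ 0 ∷ xs ++ ys)
      (trans (tabulate≡applyUpTo (λ _ → 1) (λ _ → refl)) (ones n (A queue)))
      (cong₂ (λ a l → 3 ∷ a ∷ 1 ∷ l)
        (proj₂ (index-spec (inj₂ dagRoot) root-numbered))
        (cong concat (trans
          (tabulate≡applyUpTo (ruleCode A ∘ A queue) λ i →
            trans (encode-symbolTerm (item i) (item-numbered i)) (cong (ruleCode A) (code-item i)))
          (sym (map-applyUpTo (A queue) (ruleCode A) n)))))
      where
      ones : ∀ n q → applyUpTo (λ _ → 1) n ≡ concatMap (λ _ → [ 1 ]) (applyUpTo q n)
      ones zero    q = refl
      ones (suc n) q = cong (1 ∷_) (ones n (q ∘ suc))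

    -- Linear running time.

    time-bound : 3 + (5 * V + exploreCost (A queue) n) + (1 + (1 + sumTo (λ _ → 2) (toℕ dagRoot)) +
        (10 + (3 * n + sumTo (λ i → 11 + 4 * length (row (A queue i))) n))) ≤ 40 * (1 + sizeDag D)
    time-bound = begin
      3 + (5 * V + exploreCost (A queue) n) + (1 + (1 + sumTo (λ _ → 2) (toℕ dagRoot)) +
        (10 + (3 * n + sumTo (λ i → 11 + 4 * length (row (A queue i))) n)))
        ≡⟨ cong₂ (λ x yz → 3 + (5 * V + x) + yz) (sumTo-affine 4 8 (length ∘ row ∘ A queue) n)
             (cong₂ (λ y z → 1 + (1 + y) + (10 + (3 * n + z))) (sumTo-const 2 (toℕ dagRoot))
               (sumTo-affine 11 4 (length ∘ row ∘ A queue) n)) ⟩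
      3 + (5 * V + (4 * n + 8 * work)) + (1 + (1 + toℕ dagRoot * 2) + (10 + (3 * n + (11 * n + 4 * work))))
        -- All nodes are queued, so both the number of nodes and the position of the root are at
        -- most `n`.
        ≤⟨ +-mono-≤ (+-monoʳ-≤ 3 (+-monoˡ-≤ (4 * n + 8 * work) (*-monoʳ-≤ 5 vertices-≤)))
             (+-monoˡ-≤ (10 + (3 * n + (11 * n + 4 * work))) (+-monoʳ-≤ 2
               (*-monoˡ-≤ 2 (<⇒≤ (<-≤-trans (toℕ<n dagRoot) vertices-≤))))) ⟩
      3 + (5 * n + (4 * n + 8 * work)) + (1 + (1 + n * 2) + (10 + (3 * n + (11 * n + 4 * work))))
        ≡⟨ solve 2 (λ n w → con 3 :+ (con 5 :* n :+ (con 4 :* n :+ con 8 :* w)) :+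
             (con 1 :+ (con 1 :+ n :* con 2) :+ (con 10 :+ (con 3 :* n :+ (con 11 :* n :+ con 4 :* w))))
             := con 15 :+ (con 25 :* n :+ con 12 :* w)) refl n work ⟩
      15 + (25 * n + 12 * work)
        -- Raising 12 to 15 makes the constant part 15 + 25 and the coefficient 25 + 15 of
        -- `sizeDag D` agree, which is the origin of the 40.
        ≤⟨ +-monoʳ-≤ 15 (+-mono-≤ (*-monoʳ-≤ 25 (≤-trans length≤1+work (s≤s work≤sizeDag)))
             (*-mono-≤ {12} {15} (m≤m+n 12 3) work≤sizeDag)) ⟩
      15 + (25 * (1 + sizeDag D) + 15 * sizeDag D)
        ≡⟨ solve 1 (λ d → con 15 :+ (con 25 :* (con 1 :+ d) :+ con 15 :* d) := con 40 :* (con 1 :+ d))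
             refl (sizeDag D) ⟩
      40 * (1 + sizeDag D) ∎
      where
      open ≤-Reasoning
      open +-*-Solver

    emission-reaches : Reaches (encodeDag D) (findRoot ⨾ emitGrammar) s
      (1 + (1 + sumTo (λ _ → 2) (toℕ dagRoot)) +
        (10 + (3 * n + sumTo (λ i → 11 + 4 * length (row (A queue i))) n)))
      (λ s′ → output s′ ≡ grammarCode A n rootCode)
    emission-reaches = findRoot-reaches root-unseen below-root-seen no-output
      then λ (fr , no-output) → emitGrammar-reaches fr no-output

    translate-computes : ∀ {t} → Run (encodeDag D) search initial t s →
      t ≤ 3 + (5 * V + exploreCost (A queue) n) →
      Σ[ u ∈ ℕ ] (ComputesIn translate (encodeDag D) (encodeSLT grammar) u × u ≤ 40 * (1 + sizeDag D))
    translate-computes {t} run t≤ =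
      let s′ , u , run′ , u≤ , out = emission-reaches in
      t + u , (s′ , run ⨾ run′ , trans out (sym encodeSLT-grammar)) ,
      ≤-trans (+-mono-≤ t≤ u≤) time-bound

  Result : SLTGrammar σ → Set
  Result G₁ =
    (Σ[ t ∈ ℕ ] (ComputesIn translate (encodeDag D) (encodeSLT G₁) t × t ≤ 40 * (1 + sizeDag D)))
    × evalSLT G₁ ≡ fcns (evalDag D)
    × sizeSLT G₁ ≤ sizeDag D + 2 * (V + N)

  -- The grammar is defined from the store that the search reaches, so its numbering is the one used
  -- by the output program.
  translation-correct : Σ[ G₁ ∈ SLTGrammar σ ] Result G₁
  translation-correct = from-search search-reaches
    where
    from-search : Σ[ s ∈ Store ] Σ[ t ∈ ℕ ] (Run (encodeDag D) search initial t s ×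
        t ≤ 3 + (5 * V + exploreCost (arrs s queue) (regs s queueLength)) ×
        Explored (regs s queueLength) s) → Σ[ G₁ ∈ SLTGrammar σ ] Result G₁
    from-search (s , t , run , t≤ , explored) =
      Translation.grammar D (numbering explored) ,
      translate-computes explored run t≤ ,
      Translation.evalSLT-grammar D (numbering explored) ,
      sizeSLT-grammar explored

theorem11 : (σ : ℕ) →
    Σ[ p ∈ Program ] Σ[ c ∈ ℕ ]
    ((D : CompressedDag σ) →
    Σ[ G₁ ∈ SLTGrammar σ ]
    ((Σ[ t ∈ ℕ ] (ComputesIn p (encodeDag D) (encodeSLT G₁) t × t ≤ c * (1 + sizeDag D)))
    × evalSLT G₁ ≡ fcns (evalDag D)
    × sizeSLT G₁ ≤ sizeDag D + 2 * (CompressedDag.V D + CompressedDag.N D)))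
theorem11 σ = translate , 40 , λ D → Correctness.translation-correct D
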